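{- Let $\lambda/\mu$ be a skew partition that is connected and has no empty columns, and let $\nu$ be a partition that is representable with respect to $\lambda/\mu$. Let $M=\#\nu$, let $r+1$ be the number of irreducible components of $\nu$, and let $n_0,n_1,\ldots,n_r$ be their degrees. Then \[ \sum_{T\in\operatorname{RPP}^{12}(\lambda/\mu;\nu)}\mathbf x^{\operatorname{ircont}(T)}=(x_1x_2)^{M}P_{n_0}(x_1,x_2)P_{n_1}(x_1,x_2)\cdots P_{n_r}(x_1,x_2), \] where $P_n(x_1,x_2)=x_1^n+x_1^{n-1}x_2+\cdots+x_1x_2^{n-1}+x_2^n$.
   Context: A partition $\lambda=(\lambda_1\ge\lambda_2\ge\cdots)$ is identified with its Young diagram $\{(i,j)\in\mathbb N_+^2\mid j\le\lambda_i\}$ ($i$ is the row, growing downwards; $j$ is the column). A skew partition $\lambda/\mu$ is a pair of partitions with $\mu\subseteq\lambda$, also identified with the set difference of the diagrams. "Connected" means connected as a subgraph of $\mathbb Z^2$, two cells being adjacent if they share an edge; "no empty columns" means each of the columns $1,\ldots,\lambda_1$ contains a cell of $\lambda/\mu$. A 12-rpp of shape $\lambda/\mu$ is a map $T:\lambda/\mu\to\{1,2\}$ weakly increasing from left to right along rows and from top to bottom down columns. $\operatorname{ircont}(T)=(r_1,r_2,0,0,\ldots)$, where $r_i$ is the number of columns of $T$ containing an entry $i$; $\mathbf x^{\operatorname{ircont}(T)}=x_1^{r_1}x_2^{r_2}$. For a 12-rpp $T$, let $\{(i_1,j_1),\ldots,(i_s,j_s)\}$ with $j_1<\cdots<j_s$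 be the set of all cells $(i,j)\in\lambda/\mu$ with $T(i,j)=1$, $(i+1,j)\in\lambda/\mu$ and $T(i+1,j)=2$. Then $i_1\ge\cdots\ge i_s$, and $\operatorname{seplist}(T):=(i_1,\ldots,i_s)$ (a partition). $\operatorname{RPP}^{12}(\lambda/\mu;\nu)$ is the set of all 12-rpps $T$ of shape $\lambda/\mu$ with $\operatorname{seplist}(T)=\nu$. For a positive integer $i$, $\operatorname{supp}(i)=\{j\mid (i,j),(i+1,j)\in\lambda/\mu\}=[\mu_i+1,\lambda_{i+1}]$ (an integer interval). A partition $\nu=(i_1\ge\cdots\ge i_s>0)$ of length $\#\nu=s$ is admissible if $\operatorname{supp}(i_k)\ne\varnothing$ for all $k$. For integers $a\le b$, $\nu|_{\subseteq[a,b)}$ (resp. $\nu|_{\cap[a,b)}$) is the subpartition of $\nu$ consisting of those entries $i_k$ (counted with multiplicity) with $\operatorname{supp}(i_k)\subseteq[a,b)$ (resp. $\operatorname{supp}(i_k)\cap[a,b)\ne\varnothing$); $\#$ denotes the number of entries. An admissible $\nu$ is representable if $\#\nu|_{\subseteq[a,b)}\le b-a$ for all integers $a<b$. Irreducible components: for representable $\nu$ there are a unique $r\ge 0$ and unique integers $1=b_0\le a_1<b_1<a_2<b_2<\cdots<a_r<b_r\le a_{r+1}=\lambda_1+1$ such that (1) $\#\nu|_{\subseteq[a_k,b_k)}=b_k-a_k$ for all $1\le k\le r$, and (2) the set $\bigcup_{k=0}^r[b_k,a_{k+1})$ is minimal with respect to inclusion among all such sequences satisfying (1). The irreducible components of $\nu$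 are the subpartitions $\nu|_{\cap[b_k,a_{k+1})}$ for $0\le k\le r$, and their degrees are $n_k=a_{k+1}-b_k-\#\nu|_{\cap[b_k,a_{k+1})}$ (nonnegative integers). -}

module Defs where

open import Data.Fin using (Fin; zero; suc; finToFun)
import Data.Fin as Fin
import Data.Fin.Properties as Fin
open import Data.Integer using (ℤ; 0ℤ; 1ℤ)
import Data.Integer as ℤ
open import Data.List
  using (List; []; _∷_; length; map; foldr; filter; upTo; allFin; lookup; cartesianProductWith)
open import Data.List.Membership.Propositional using () renaming (_∈_ to _∈ˡ_)
open import Data.List.Membership.Propositional.Properties
  using (∈-map⁺; ∈-filter⁺; ∈-upTo⁺; ∈-cartesianProductWith⁺)
import Data.List.Properties as List
open import Data.List.Relation.Unary.All using (All)
import Data.List.Relation.Unary.All.Properties as All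
open import Data.List.Relation.Unary.Linked using (Linked; _∷_)
import Data.List.Relation.Unary.Linked.Properties as Linked
open import Data.List.Relation.Unary.Unique.Propositional using (Unique)
import Data.List.Relation.Unary.Unique.Propositional.Properties as Unique
open import Data.Nat
  using (ℕ; zero; suc; _∸_; _≤_; _<_; _>_; _≥_; z≤n; s≤s; _≟_; _≤?_; _<?_)
open import Data.Nat.Properties
  using (≤-refl; ≤-trans; suc-injective; anyUpTo?; allUpTo?)
open import Data.Product using (_×_; _,_; proj₁; proj₂; ∃)
open import Data.Product.Properties using (≡-dec)
open import Data.Sum using (_⊎_)
open import Function using (_∘_)
open import Level using (0ℓ)
open import Relation.Binary.Construct.Closure.ReflexiveTransitive using (Star)
open import Relation.Binary.PropositionalEquality using (_≡_; refl)
open import Relation.Nullary using (Dec; _×-dec_; _→-dec_; ¬?)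
open import Relation.Nullary.Decidable using (map′)
open import Relation.Unary using (Pred; Decidable; _∈_; _⊆_; _∖_; _≬_; Satisfiable)

-- 1, 2, …, n
⟦_⟧ : ℕ → List ℕ
⟦ n ⟧ = map suc (upTo n)

record Partition : Set where
  field
    parts      : List ℕ
    decreasing : Linked _≥_ parts
    positive   : All (_> 0) parts

open Partition public

#_ : Partition → ℕ
# ν = length (parts ν)

-- 1-based lookup, padded with zeros (also at the unused index 0).
nth : List ℕ → ℕ → ℕ
nth []       _             = 0
nth (x ∷ xs) 0             = 0
nth (x ∷ xs) 1             = x
nth (x ∷ xs) (suc (suc i)) = nth xs (suc i)

part : Partition → ℕ → ℕ
part ν i = nth (parts ν) i

subpartition : {P : Pred ℕ 0ℓ} → Decidable P → Partition → Partition
subpartition P? ν = record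
  { parts      = filter P? (parts ν)
  ; decreasing = Linked.filter⁺ P? (λ p q → ≤-trans q p) (decreasing ν)
  ; positive   = All.filter⁺ P? (positive ν)
  }

-- A cell is a pair (row , column), both 1-based.
Diagram : Partition → Pred (ℕ × ℕ) 0ℓ
Diagram ν (i , j) = 1 ≤ i × 1 ≤ j × j ≤ part ν i

record SkewPartition : Set where
  field
    outer : Partition
    inner : Partition
    inner⊆outer : Diagram inner ⊆ Diagram outer

open SkewPartition public

-- λ₁
width : SkewPartition → ℕ
width S = part (outer S) 1

Shape : SkewPartition → Pred (ℕ × ℕ) 0ℓ
Shape S = Diagram (outer S) ∖ Diagram (inner S)

Diagram? : ∀ ν → Decidable (Diagram ν)
Diagram? ν (i , j) = 1 ≤? i ×-dec 1 ≤? j ×-dec j ≤? part ν i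

Shape? : ∀ S → Decidable (Shape S)
Shape? S c = Diagram? (outer S) c ×-dec ¬? (Diagram? (inner S) c)

nth-≤-first : ∀ {xs} → Linked _≥_ xs → ∀ i → nth xs i ≤ nth xs 1
nth-≤-first {[]}         _        i             = z≤n
nth-≤-first {x ∷ xs}     _        0             = z≤n
nth-≤-first {x ∷ xs}     _        1             = ≤-refl
nth-≤-first {x ∷ []}     _        (suc (suc i)) = z≤n
nth-≤-first {x ∷ y ∷ xs} (x≥y ∷ p) (suc (suc i)) = ≤-trans (nth-≤-first p (suc i)) x≥y

column≤width : ∀ S {i j} → (i , j) ∈ Shape S → j ≤ width S
column≤width S {i} ((_ , _ , j≤) , _) = ≤-trans j≤ (nth-≤-first (decreasing (outer S)) i)

Adjacent : ℕ × ℕ → ℕ × ℕ → Set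
Adjacent (i , j) (i′ , j′) =
  (i ≡ i′ × (suc j ≡ j′ ⊎ j ≡ suc j′)) ⊎ (j ≡ j′ × (suc i ≡ i′ ⊎ i ≡ suc i′))

-- The empty shape counts as connected.
Connected : SkewPartition → Set
Connected S = ∀ {c d} → c ∈ Shape S → d ∈ Shape S →
  Star (λ x y → x ∈ Shape S × y ∈ Shape S × Adjacent x y) c d

NoEmptyColumns : SkewPartition → Set
NoEmptyColumns S = ∀ j → 1 ≤ j → j ≤ width S → ∃ λ i → (i , j) ∈ Shape S

-- The cells of the shape, column by column from left to right; each is listed
-- exactly once (cells-complete, cells-unique).
cells : SkewPartition → List (ℕ × ℕ)
cells S = filter (Shape? S)
  (cartesianProductWith (λ j i → i , j) ⟦ width S ⟧ ⟦ # outer S ⟧)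

∈-⟦⟧ : ∀ {i n} → 1 ≤ i → i ≤ n → i ∈ˡ ⟦ n ⟧
∈-⟦⟧ {suc i} _ i<n = ∈-map⁺ suc (∈-upTo⁺ i<n)

nonzero⇒≤length : ∀ xs i → 1 ≤ nth xs i → i ≤ length xs
nonzero⇒≤length (x ∷ xs) 0             _ = z≤n
nonzero⇒≤length (x ∷ xs) 1             _ = s≤s z≤n
nonzero⇒≤length (x ∷ xs) (suc (suc i)) p = s≤s (nonzero⇒≤length xs (suc i) p)

unique-⟦⟧ : ∀ n → Unique ⟦ n ⟧
unique-⟦⟧ n = Unique.map⁺ suc-injective (Unique.upTo⁺ n)

cells-complete : ∀ S {c} → c ∈ Shape S → c ∈ˡ cells S
cells-complete S {i , j} c∈@((1≤i , 1≤j , j≤) , _) =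
  ∈-filter⁺ (Shape? S)
    (∈-cartesianProductWith⁺ _ (∈-⟦⟧ 1≤j (column≤width S c∈))
      (∈-⟦⟧ 1≤i (nonzero⇒≤length (parts (outer S)) i (≤-trans 1≤j j≤))))
    c∈

cells-unique : ∀ S → Unique (cells S)
cells-unique S = Unique.filter⁺ (Shape? S)
  (Unique.cartesianProductWith⁺ _ (λ { refl → refl , refl })
    (unique-⟦⟧ (width S)) (unique-⟦⟧ (# outer S)))

Cell : SkewPartition → Set
Cell S = Fin (length (cells S))

coords : ∀ S → Cell S → ℕ × ℕ
coords S = lookup (cells S)

row col : ∀ S → Cell S → ℕ
row S = proj₁ ∘ coords S
col S = proj₂ ∘ coords S

-- 𝟙 and 𝟚 stand for the entries 1 and 2.
Entry : Set
Entry = Fin 2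

pattern 𝟙 = zero
pattern 𝟚 = suc zero

Filling : SkewPartition → Set
Filling S = Cell S → Entry

-- Every map Cell S → Entry, exactly once (up to pointwise equality):
-- finToFun is the standard enumeration of functions between finite sets.
fillings : ∀ S → List (Filling S)
fillings S = map finToFun (allFin _)

module _ (S : SkewPartition) (T : Filling S) where

  IsRPP : Set
  IsRPP = (∀ c d → row S c ≡ row S d → col S c ≤ col S d → T c Fin.≤ T d)
        × (∀ c d → col S c ≡ col S d → row S c ≤ row S d → T c Fin.≤ T d)

  IsRPP? : Dec IsRPP
  IsRPP? =
    Fin.all? (λ c → Fin.all? λ d →
      row S c ≟ row S d →-dec col S c ≤? col S d →-dec T c Fin.≤? T d)
    ×-dec
    Fin.all? (λ c → Fin.all? λ d →
      col S c ≟ col S d →-dec row S c ≤? row S d →-dec T c Fin.≤? T d)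

  InColumn : Entry → Pred ℕ 0ℓ
  InColumn e j = ∃ λ c → col S c ≡ j × T c ≡ e

  InColumn? : ∀ e → Decidable (InColumn e)
  InColumn? e j = Fin.any? λ c → col S c ≟ j ×-dec T c Fin.≟ e

  -- r₁ for e = 𝟙 and r₂ for e = 𝟚
  ircont : Entry → ℕ
  ircont e = length (filter (InColumn? e) ⟦ width S ⟧)

  Separates : Pred (Cell S) 0ℓ
  Separates c = T c ≡ 𝟙 × ∃ λ d → coords S d ≡ (suc (row S c) , col S c) × T d ≡ 𝟚

  Separates? : Decidable Separates
  Separates? c = T c Fin.≟ 𝟙 ×-dec
    Fin.any? λ d → ≡-dec _≟_ _≟_ (coords S d) (suc (row S c) , col S c) ×-dec T d Fin.≟ 𝟚

  -- Listed by increasing column, since allFin follows the order of cells S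
  -- (an rpp has at most one separating cell in each column).
  seplist : List ℕ
  seplist = map (row S) (filter Separates? (allFin _))

RPP¹² : (S : SkewPartition) → Partition → List (Filling S)
RPP¹² S ν =
  filter (λ T → IsRPP? S T ×-dec List.≡-dec _≟_ (seplist S T) (parts ν)) (fillings S)

-- Columns are positive, so natural-number endpoints give all the relevant
-- integer intervals [a, b).
[_,_⟩ : ℕ → ℕ → Pred ℕ 0ℓ
[ a , b ⟩ x = a ≤ x × x < b

[_,_⟩? : ∀ a b → Decidable [ a , b ⟩
[ a , b ⟩? x = a ≤? x ×-dec x <? b

supp : SkewPartition → ℕ → Pred ℕ 0ℓ
supp S i j = (i , j) ∈ Shape S × (suc i , j) ∈ Shape S

supp? : ∀ S i → Decidable (supp S i)
supp? S i j = Shape? S (i , j) ×-dec Shape? S (suc i , j)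

supp⊆? : ∀ S a b → Decidable (λ i → supp S i ⊆ [ a , b ⟩)
supp⊆? S a b i = map′
  (λ (f : ∀ {j} → j < suc (width S) → j ∈ supp S i → j ∈ [ a , b ⟩) {j} p →
    f (s≤s (column≤width S {i} {j} (proj₁ p))) p)
  (λ f _ → f)
  (allUpTo? (λ j → supp? S i j →-dec [ a , b ⟩? j) (suc (width S)))

supp≬? : ∀ S a b → Decidable (λ i → supp S i ≬ [ a , b ⟩)
supp≬? S a b i = map′
  (λ (j , _ , p) → j , p)
  (λ (j , p) → j , s≤s (column≤width S {i} {j} (proj₁ (proj₁ p))) , p)
  (anyUpTo? (λ j → supp? S i j ×-dec [ a , b ⟩? j) (suc (width S)))

-- ν|_{⊆[a,b)} and ν|_{∩[a,b)}
restrict⊆ restrict∩ : SkewPartition → Partition → ℕ → ℕ → Partition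
restrict⊆ S ν a b = subpartition (supp⊆? S a b) ν
restrict∩ S ν a b = subpartition (supp≬? S a b) ν

Admissible : SkewPartition → Partition → Set
Admissible S ν = All (λ i → Satisfiable (supp S i)) (parts ν)

Representable : SkewPartition → Partition → Set
Representable S ν = Admissible S ν ×
  (∀ a b → a < b → # restrict⊆ S ν a b ≤ b ∸ a)

-- Sequences 1 = b₀ ≤ a₁ < b₁ < a₂ < ⋯ < a_r < b_r ≤ a_{r+1} = λ₁ + 1 such that
-- #ν|_{⊆[a_k,b_k)} = b_k − a_k for 1 ≤ k ≤ r.  Only b 0, …, b r and
-- a 1, …, a (r + 1) carry meaning.
record TightSequence (S : SkewPartition) (ν : Partition) : Set where
  field
    r     : ℕ
    a b   : ℕ → ℕ
    first : b 0 ≡ 1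
    last  : a (suc r) ≡ suc (width S)
    b₀≤a₁ : b 0 ≤ a 1
    a<b   : ∀ k → 1 ≤ k → k ≤ r → a k < b k
    b<a   : ∀ k → 1 ≤ k → k < r → b k < a (suc k)
    bᵣ≤aᵣ₊₁ : b r ≤ a (suc r)
    tight : ∀ k → 1 ≤ k → k ≤ r → # restrict⊆ S ν (a k) (b k) ≡ b k ∸ a k

  -- ⋃ₖ [b_k, a_{k+1})
  support : Pred ℕ 0ℓ
  support x = ∃ λ k → k ≤ r × x ∈ [ b k , a (suc k) ⟩

  component : ℕ → Partition
  component k = restrict∩ S ν (b k) (a (suc k))

  -- For representable ν both truncated subtractions are genuine ones.
  degree : ℕ → ℕ
  degree k = a (suc k) ∸ b k ∸ # component k

  -- n₀, …, n_r
  degrees : List ℕ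
  degrees = map degree (upTo (suc r))

record IrreducibleDecomposition (S : SkewPartition) (ν : Partition) : Set where
  field
    sequence : TightSequence S ν
  open TightSequence sequence public
  field
    minimal : (σ : TightSequence S ν) →
      TightSequence.support σ ⊆ support → support ⊆ TightSequence.support σ

-- f p q is the coefficient of x₁^p x₂^q.  Finite support is not imposed, so these
-- are the power series over ℤ, containing ℤ[x₁, x₂].
Poly : Set
Poly = ℕ → ℕ → ℤ

infix  4 _≈_
infixl 6 _⊕_
infixl 7 _⊗_
infixr 8 _^_

_≈_ : Poly → Poly → Set
f ≈ g = ∀ p q → f p q ≡ g p q

𝟘ᴾ 𝟙ᴾ x₁ x₂ : Poly
𝟘ᴾ _ _ = 0ℤ

𝟙ᴾ 0 0 = 1ℤ
𝟙ᴾ _ _ = 0ℤ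

x₁ 1 0 = 1ℤ
x₁ _ _ = 0ℤ

x₂ 0 1 = 1ℤ
x₂ _ _ = 0ℤ

_⊕_ : Poly → Poly → Poly
(f ⊕ g) p q = f p q ℤ.+ g p q

-- f 0 + f 1 + ⋯ + f n
sumUpTo : ℕ → (ℕ → ℤ) → ℤ
sumUpTo n f = foldr ℤ._+_ 0ℤ (map f (upTo (suc n)))

_⊗_ : Poly → Poly → Poly
(f ⊗ g) p q = sumUpTo p λ i → sumUpTo q λ j → f i j ℤ.* g (p ∸ i) (q ∸ j)

_^_ : Poly → ℕ → Poly
f ^ zero  = 𝟙ᴾ
f ^ suc n = f ⊗ f ^ n

∑ ∏ : List Poly → Poly
∑ = foldr _⊕_ 𝟘ᴾ
∏ = foldr _⊗_ 𝟙ᴾ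

x^ircont : ∀ S → Filling S → Poly
x^ircont S T = x₁ ^ ircont S T 𝟙 ⊗ x₂ ^ ircont S T 𝟚

-- x₁ⁿ + x₁ⁿ⁻¹x₂ + ⋯ + x₂ⁿ
P : ℕ → Poly
P n = ∑ (map (λ i → x₁ ^ (n ∸ i) ⊗ x₂ ^ i) (upTo (suc n)))

{-# OPTIONS --safe #-}

-- Call a column of a 12-rpp one, two or star according to whether it is pure 1, pure 2 or mixed.
-- The k-th mixed column has its separator in row ν_k, so an rpp with seplist ν is determined by
-- its word of column types.  Let α(x) count the mixed columns left of x, and L(x), U(x) the
-- entries of ν whose support begins, respectively ends, left of x.  A word comes from an rpp iff
-- U(x) ≤ α(x) and α(x) + 1 ≤ L(x+1) at each star, α(x) = U(x) at each one, α(x) = L(x+1) at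
-- each two, and no one directly follows a two; the last condition expresses connectedness.
--
-- Hence α is a lattice path between lo, the path with all mixed columns as far to the right as
-- possible, and hi, where they are as far to the left as possible; it is horizontal only along lo
-- (at ones) and along hi (at twos).  Representability is Hall's condition lo ≤ hi.  The columns in
-- tight intervals are those with hi(x) < lo(x+1), which are mixed in every rpp, and minimality
-- says that the irreducible components cover exactly the remaining columns.  Inside a component
-- a two is never followed by a one, so its n pure columns read 1…12…2, and each of the n + 1
-- possible numbers of ones is realised by exactly one path; this is the factor P n.
module Submission where

open import Defs
open import Data.Bool using (Bool; true; false)
import Data.Bool.Properties as Bool
open import Data.Empty using (⊥-elim)
open import Data.Fin using (Fin; finToFun; funToFin; combine)
import Data.Fin as Fin
import Data.Fin.Properties as Fin
open import Data.Integer using (ℤ; 0ℤ; 1ℤ)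
import Data.Integer as ℤ
import Data.Integer.Properties as ℤ
open import Data.Integer.Tactic.RingSolver using () renaming (solve-∀ to ℤ-solve-∀)
open import Data.List
  using (List; []; _∷_; _++_; map; foldr; length; filter; lookup; allFin; upTo; applyUpTo;
         concatMap; cartesianProductWith)
open import Data.List.Membership.Propositional using () renaming (_∈_ to _∈ˡ_)
open import Data.List.Membership.Propositional.Properties
  using (∈-map⁺; ∈-map⁻; ∈-++⁺ˡ; ∈-++⁺ʳ; ∈-++⁻; ∈-filter⁺; ∈-filter⁻; ∈-concatMap⁻; ∈-lookup; ∈-allFin)
open import Data.List.Membership.Propositional.Properties.WithK using (unique∧set⇒bag)
import Data.List.Properties as List
open import Data.List.Relation.Binary.BagAndSetEquality using (∼bag⇒↭)
open import Data.List.Relation.Binary.Permutation.Propositional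
  using (_↭_; prep; swap; ↭-trans; ↭-reflexive)
import Data.List.Relation.Binary.Permutation.Propositional as ↭
open import Data.List.Relation.Binary.Permutation.Propositional.Properties using (map⁺; ++⁺)
open import Data.List.Relation.Unary.All as All using (All; []; _∷_)
import Data.List.Relation.Unary.All.Properties as All
open import Data.List.Relation.Unary.AllPairs as AllPairs using (AllPairs; []; _∷_)
import Data.List.Relation.Unary.AllPairs.Properties as AllPairs
open import Data.List.Relation.Unary.Any using (Any; here; there; index)
import Data.List.Relation.Unary.Any.Properties as Any
open import Data.List.Relation.Unary.Linked using (Linked; _∷_)
import Data.List.Relation.Unary.Linked.Properties as Linked
open import Data.List.Relation.Unary.Unique.Propositional using (Unique)
import Data.List.Relation.Unary.Unique.Propositional.Properties as Unique
open import Data.Nat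
  using (ℕ; zero; suc; _+_; _∸_; _≤_; _<_; _≥_; _⊔_; _⊓_; _≟_; _≤?_; _<?_; z≤n; s≤s)
import Data.Nat as ℕ
import Data.Nat.Properties as ℕ
open import Data.Nat.Tactic.RingSolver using () renaming (solve-∀ to ℕ-solve-∀)
open import Data.Product using (_×_; _,_; proj₁; proj₂; ∃)
open import Data.Product.Properties using (≡-dec)
open import Data.Sum using (_⊎_; inj₁; inj₂)
open import Function using (_∘_; id; mk⇔)
open import Level using (0ℓ)
open import Relation.Binary using (tri<; tri≈; tri>)
open import Relation.Binary.Construct.Closure.ReflexiveTransitive using (Star; ε; _◅_)
open import Relation.Binary.PropositionalEquality
  using (_≡_; _≗_; refl; sym; trans; cong; cong₂; subst; subst₂; module ≡-Reasoning)
open import Relation.Nullary using (Dec; yes; no; ¬_; contradiction; _×-dec_)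
open import Relation.Unary using (Pred; Decidable; _∈_; _⊆_)

-- Polynomials as lists of exponents

-- Unfolded, hi(x) is the minimum of L(a) + (x - a) over a ≤ x, and lo(x) is the maximum of U(b) -
-- (b - x) over b ≥ x, so lo ≤ hi everywhere means U(b) - L(a) ≤ b - a for all a ≤ b. Because ν
-- decreases, the entries whose support begins (or ends) left of a given column form a prefix of ν.
-- Hence U(b) - L(a) counts the supports inside [a, b), which is how representability enters, and
-- L(b) - U(a) counts the supports meeting [a, b), which makes a degree a number of pure columns.
--
-- The factors multiply because both paths meet at the ends of each tight interval, and the mixed
-- columns inside it separate a two from any later one. The given decomposition is known only
-- through its minimality, so its support is compared with that of an explicit chain, built from
-- right to left.
--
-- Polynomials are compared as lists of exponents up to permutation, which turns the identity into a
-- bijection of words.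

δ : ℕ → ℕ → ℤ
δ zero    zero    = 1ℤ
δ zero    (suc _) = 0ℤ
δ (suc _) zero    = 0ℤ
δ (suc a) (suc p) = δ a p

Exponent : Set
Exponent = ℕ × ℕ

infixl 6 _∔_

_∔_ : Exponent → Exponent → Exponent
(a , b) ∔ (c , d) = a + c , b + d

monomial : Exponent → Poly
monomial (a , b) p q = δ a p ℤ.* δ b q

sumUpTo-suc : ∀ n f → sumUpTo (suc n) f ≡ f 0 ℤ.+ sumUpTo n (f ∘ suc)
sumUpTo-suc n f = cong (λ xs → f 0 ℤ.+ foldr ℤ._+_ 0ℤ xs)
  (trans (List.map-applyUpTo suc f (suc n)) (sym (List.map-applyUpTo id (f ∘ suc) (suc n))))

sumUpTo-cong : ∀ n {f g} → (∀ i → f i ≡ g i) → sumUpTo n f ≡ sumUpTo n g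
sumUpTo-cong n eq = cong (foldr ℤ._+_ 0ℤ) (List.map-cong eq (upTo (suc n)))

sumUpTo-zero : ∀ n {f} → (∀ i → f i ≡ 0ℤ) → sumUpTo n f ≡ 0ℤ
sumUpTo-zero zero    eq rewrite eq 0 = refl
sumUpTo-zero (suc n) {f} eq rewrite sumUpTo-suc n f | eq 0 =
  trans (ℤ.+-identityˡ _) (sumUpTo-zero n (eq ∘ suc))

sumUpTo-+ : ∀ n f g → sumUpTo n (λ i → f i ℤ.+ g i) ≡ sumUpTo n f ℤ.+ sumUpTo n g
sumUpTo-+ n f g = go (upTo (suc n))
  where
  interchange : ∀ a b c d → (a ℤ.+ b) ℤ.+ (c ℤ.+ d) ≡ (a ℤ.+ c) ℤ.+ (b ℤ.+ d)
  interchange = ℤ-solve-∀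
  go : ∀ xs → foldr ℤ._+_ 0ℤ (map (λ i → f i ℤ.+ g i) xs)
            ≡ foldr ℤ._+_ 0ℤ (map f xs) ℤ.+ foldr ℤ._+_ 0ℤ (map g xs)
  go []       = refl
  go (x ∷ xs) = trans (cong (ℤ._+_ (f x ℤ.+ g x)) (go xs)) (interchange (f x) (g x) _ _)

sumUpTo-*ˡ : ∀ n k f → sumUpTo n (λ i → k ℤ.* f i) ≡ k ℤ.* sumUpTo n f
sumUpTo-*ˡ n k f = go (upTo (suc n))
  where
  go : ∀ xs → foldr ℤ._+_ 0ℤ (map (λ i → k ℤ.* f i) xs) ≡ k ℤ.* foldr ℤ._+_ 0ℤ (map f xs)
  go []       = sym (ℤ.*-zeroʳ k)
  go (x ∷ xs) = trans (cong (ℤ._+_ (k ℤ.* f x)) (go xs)) (sym (ℤ.*-distribˡ-+ k (f x) _))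

sumUpTo-*ʳ : ∀ n k f → sumUpTo n (λ i → f i ℤ.* k) ≡ sumUpTo n f ℤ.* k
sumUpTo-*ʳ n k f = trans (sumUpTo-cong n (λ i → ℤ.*-comm (f i) k))
  (trans (sumUpTo-*ˡ n k f) (ℤ.*-comm k _))

-- `δ a` is the coefficient sequence of the a-th power of one variable, so this is the law of
-- exponents. In `monomial-⊗` the double sum factors into two such convolutions.
δ-convolution : ∀ a c n → sumUpTo n (λ i → δ a i ℤ.* δ c (n ∸ i)) ≡ δ (a + c) n
δ-convolution zero c zero = trans (ℤ.+-identityʳ _) (ℤ.*-identityˡ _)
δ-convolution zero c (suc n) = trans (sumUpTo-suc n (λ i → δ 0 i ℤ.* δ c (suc n ∸ i)))
  (trans (cong₂ ℤ._+_ (ℤ.*-identityˡ (δ c (suc n))) (sumUpTo-zero n (λ i → ℤ.*-zeroˡ (δ c (n ∸ i)))))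
         (ℤ.+-identityʳ _))
δ-convolution (suc a) c zero = trans (ℤ.+-identityʳ _) (ℤ.*-zeroˡ (δ c 0))
δ-convolution (suc a) c (suc n) = trans (sumUpTo-suc n (λ i → δ (suc a) i ℤ.* δ c (suc n ∸ i)))
  (trans (cong₂ ℤ._+_ (ℤ.*-zeroˡ (δ c (suc n))) (δ-convolution a c n)) (ℤ.+-identityˡ _))

monomial-⊗ : ∀ e f → monomial e ⊗ monomial f ≈ monomial (e ∔ f)
monomial-⊗ (a , b) (c , d) p q = begin
  sumUpTo p (λ i → sumUpTo q λ j → (δ a i ℤ.* δ b j) ℤ.* (δ c (p ∸ i) ℤ.* δ d (q ∸ j)))
    ≡⟨ sumUpTo-cong p (λ i → trans
         (sumUpTo-cong q (λ j → interchange (δ a i) (δ b j) (δ c (p ∸ i)) (δ d (q ∸ j))))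
         (sumUpTo-*ˡ q (δ a i ℤ.* δ c (p ∸ i)) (λ j → δ b j ℤ.* δ d (q ∸ j)))) ⟩
  sumUpTo p (λ i → (δ a i ℤ.* δ c (p ∸ i)) ℤ.* sumUpTo q (λ j → δ b j ℤ.* δ d (q ∸ j)))
    ≡⟨ sumUpTo-*ʳ p _ (λ i → δ a i ℤ.* δ c (p ∸ i)) ⟩
  sumUpTo p (λ i → δ a i ℤ.* δ c (p ∸ i)) ℤ.* sumUpTo q (λ j → δ b j ℤ.* δ d (q ∸ j))
    ≡⟨ cong₂ ℤ._*_ (δ-convolution a c p) (δ-convolution b d q) ⟩
  δ (a + c) p ℤ.* δ (b + d) q ∎
  where
  open ≡-Reasoning
  interchange : ∀ a b c d → (a ℤ.* b) ℤ.* (c ℤ.* d) ≡ (a ℤ.* c) ℤ.* (b ℤ.* d)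
  interchange = ℤ-solve-∀

≈-trans : ∀ {f g h} → f ≈ g → g ≈ h → f ≈ h
≈-trans e e′ p q = trans (e p q) (e′ p q)

⊗-cong : ∀ {f f′ g g′} → f ≈ f′ → g ≈ g′ → f ⊗ g ≈ f′ ⊗ g′
⊗-cong e e′ p q = sumUpTo-cong p λ i → sumUpTo-cong q λ j → cong₂ ℤ._*_ (e i j) (e′ (p ∸ i) (q ∸ j))

⊕-cong : ∀ {f f′ g g′} → f ≈ f′ → g ≈ g′ → f ⊕ g ≈ f′ ⊕ g′
⊕-cong e e′ p q = cong₂ ℤ._+_ (e p q) (e′ p q)

⊗-zeroˡ : ∀ g → 𝟘ᴾ ⊗ g ≈ 𝟘ᴾ
⊗-zeroˡ g p q = sumUpTo-zero p λ i → sumUpTo-zero q λ j → ℤ.*-zeroˡ (g (p ∸ i) (q ∸ j))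

⊗-zeroʳ : ∀ f → f ⊗ 𝟘ᴾ ≈ 𝟘ᴾ
⊗-zeroʳ f p q = sumUpTo-zero p λ i → sumUpTo-zero q λ j → ℤ.*-zeroʳ (f i j)

⊗-distribʳ-⊕ : ∀ f g h → (f ⊕ g) ⊗ h ≈ f ⊗ h ⊕ g ⊗ h
⊗-distribʳ-⊕ f g h p q = trans
  (sumUpTo-cong p λ i → trans
    (sumUpTo-cong q λ j → ℤ.*-distribʳ-+ (h (p ∸ i) (q ∸ j)) (f i j) (g i j))
    (sumUpTo-+ q (λ j → f i j ℤ.* h (p ∸ i) (q ∸ j)) (λ j → g i j ℤ.* h (p ∸ i) (q ∸ j))))
  (sumUpTo-+ p (λ i → sumUpTo q λ j → f i j ℤ.* h (p ∸ i) (q ∸ j)) (λ i → sumUpTo q λ j → g i j ℤ.* h (p ∸ i) (q ∸ j)))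

⊗-distribˡ-⊕ : ∀ f g h → f ⊗ (g ⊕ h) ≈ f ⊗ g ⊕ f ⊗ h
⊗-distribˡ-⊕ f g h p q = trans
  (sumUpTo-cong p λ i → trans
    (sumUpTo-cong q λ j → ℤ.*-distribˡ-+ (f i j) (g (p ∸ i) (q ∸ j)) (h (p ∸ i) (q ∸ j)))
    (sumUpTo-+ q (λ j → f i j ℤ.* g (p ∸ i) (q ∸ j)) (λ j → f i j ℤ.* h (p ∸ i) (q ∸ j))))
  (sumUpTo-+ p (λ i → sumUpTo q λ j → f i j ℤ.* g (p ∸ i) (q ∸ j)) (λ i → sumUpTo q λ j → f i j ℤ.* h (p ∸ i) (q ∸ j)))

-- A list of exponents stands for a polynomial with natural coefficients, multiplicity being the
-- coefficient. By `⟪⟫-↭` a permutation of lists suffices for equality of polynomials.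
⟪_⟫ : List Exponent → Poly
⟪ es ⟫ = ∑ (map monomial es)

infixr 7 _⊛_

_⊛_ : List Exponent → List Exponent → List Exponent
_⊛_ = cartesianProductWith _∔_

⟪⟫-++ : ∀ es fs → ⟪ es ⟫ ⊕ ⟪ fs ⟫ ≈ ⟪ es ++ fs ⟫
⟪⟫-++ []       fs p q = ℤ.+-identityˡ _
⟪⟫-++ (e ∷ es) fs p q =
  trans (ℤ.+-assoc (monomial e p q) _ _) (cong (ℤ._+_ (monomial e p q)) (⟪⟫-++ es fs p q))

⟪⟫-↭ : ∀ {es fs} → es ↭ fs → ⟪ es ⟫ ≈ ⟪ fs ⟫
⟪⟫-↭ ↭.refl         p q = refl
⟪⟫-↭ (prep e r)     p q = cong (ℤ._+_ (monomial e p q)) (⟪⟫-↭ r p q)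
⟪⟫-↭ (swap {xs = es} e f r) p q = trans
  (cong (λ z → monomial e p q ℤ.+ (monomial f p q ℤ.+ z)) (⟪⟫-↭ r p q))
  (exchange (monomial e p q) (monomial f p q) _)
  where
  exchange : ∀ a b c → a ℤ.+ (b ℤ.+ c) ≡ b ℤ.+ (a ℤ.+ c)
  exchange = ℤ-solve-∀
⟪⟫-↭ (↭.trans r r′) p q = trans (⟪⟫-↭ r p q) (⟪⟫-↭ r′ p q)

monomial-⊗-⟪⟫ : ∀ e fs → monomial e ⊗ ⟪ fs ⟫ ≈ ⟪ map (e ∔_) fs ⟫
monomial-⊗-⟪⟫ e []       = ⊗-zeroʳ (monomial e)
monomial-⊗-⟪⟫ e (f ∷ fs) = ≈-trans (⊗-distribˡ-⊕ (monomial e) (monomial f) ⟪ fs ⟫)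
  (⊕-cong (monomial-⊗ e f) (monomial-⊗-⟪⟫ e fs))

⟪⟫-⊗ : ∀ es fs → ⟪ es ⟫ ⊗ ⟪ fs ⟫ ≈ ⟪ es ⊛ fs ⟫
⟪⟫-⊗ []       fs = ⊗-zeroˡ ⟪ fs ⟫
⟪⟫-⊗ (e ∷ es) fs = ≈-trans (⊗-distribʳ-⊕ (monomial e) ⟪ es ⟫ ⟪ fs ⟫)
  (≈-trans (⊕-cong (monomial-⊗-⟪⟫ e fs) (⟪⟫-⊗ es fs)) (⟪⟫-++ (map (e ∔_) fs) (es ⊛ fs)))

𝟙ᴾ-monomial : 𝟙ᴾ ≈ monomial (0 , 0)
𝟙ᴾ-monomial zero    zero    = refl
𝟙ᴾ-monomial zero    (suc q) = refl
𝟙ᴾ-monomial (suc p) q       = sym (ℤ.*-zeroˡ (δ 0 q))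

x₁-monomial : x₁ ≈ monomial (1 , 0)
x₁-monomial zero          q       = sym (ℤ.*-zeroˡ (δ 0 q))
x₁-monomial (suc zero)    zero    = refl
x₁-monomial (suc zero)    (suc q) = refl
x₁-monomial (suc (suc p)) q       = sym (ℤ.*-zeroˡ (δ 0 q))

x₂-monomial : x₂ ≈ monomial (0 , 1)
x₂-monomial zero    zero          = refl
x₂-monomial zero    (suc zero)    = refl
x₂-monomial zero    (suc (suc q)) = refl
x₂-monomial (suc p) q             = sym (ℤ.*-zeroˡ (δ 1 q))

-- The exponent of the n-th power is supplied as a function `g` instead of a product, so that its
-- recursion holds by `refl` in every use.
^-monomial : ∀ {f a b} → f ≈ monomial (a , b) → (g : ℕ → Exponent) → g 0 ≡ (0 , 0) →
  (∀ n → (a , b) ∔ g n ≡ g (suc n)) → ∀ n → f ^ n ≈ monomial (g n)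
^-monomial e g g0 gs zero p q rewrite g0 = 𝟙ᴾ-monomial p q
^-monomial {a = a} {b} e g g0 gs (suc n) =
  ≈-trans (⊗-cong e (^-monomial e g g0 gs n))
    (λ p q → trans (monomial-⊗ (a , b) (g n) p q) (cong (λ z → monomial z p q) (gs n)))

x₁x₂-monomial : ∀ m n → x₁ ^ m ⊗ x₂ ^ n ≈ monomial (m , n)
x₁x₂-monomial m n = ≈-trans
  (⊗-cong (^-monomial x₁-monomial (_, 0) refl (λ _ → refl) m)
          (^-monomial x₂-monomial (0 ,_) refl (λ _ → refl) n))
  λ p q → trans (monomial-⊗ (m , 0) (0 , n) p q)
                (cong (λ z → monomial (z , n) p q) (ℕ.+-identityʳ m))

[x₁x₂]^-monomial : ∀ n → (x₁ ⊗ x₂) ^ n ≈ monomial (n , n)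
[x₁x₂]^-monomial = ^-monomial
  (≈-trans (⊗-cong x₁-monomial x₂-monomial) (monomial-⊗ (1 , 0) (0 , 1)))
  (λ n → n , n) refl (λ _ → refl)

∑-cong : ∀ {A : Set} {f g : A → Poly} → (∀ x → f x ≈ g x) → ∀ xs → ∑ (map f xs) ≈ ∑ (map g xs)
∑-cong e []       p q = refl
∑-cong e (x ∷ xs) = ⊕-cong (e x) (∑-cong e xs)

P-exponents : ℕ → List Exponent
P-exponents n = map (λ i → n ∸ i , i) (upTo (suc n))

∑-monomials : ∀ {A : Set} (f : A → Poly) (g : A → Exponent) →
  (∀ x → f x ≈ monomial (g x)) → ∀ xs → ∑ (map f xs) ≈ ⟪ map g xs ⟫
∑-monomials f g e xs = ≈-trans (∑-cong e xs)
  (λ p q → cong (λ z → ∑ z p q) (List.map-∘ xs))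

P-⟪⟫ : ∀ n → P n ≈ ⟪ P-exponents n ⟫
P-⟪⟫ n = ∑-monomials _ (λ i → n ∸ i , i) (λ i → x₁x₂-monomial (n ∸ i) i) (upTo (suc n))

∏P-exponents : List ℕ → List Exponent
∏P-exponents = foldr (λ n es → P-exponents n ⊛ es) ((0 , 0) ∷ [])

∏P-⟪⟫ : ∀ ns → ∏ (map P ns) ≈ ⟪ ∏P-exponents ns ⟫
∏P-⟪⟫ []       p q = trans (𝟙ᴾ-monomial p q) (sym (ℤ.+-identityʳ _))
∏P-⟪⟫ (n ∷ ns) = ≈-trans (⊗-cong (P-⟪⟫ n) (∏P-⟪⟫ ns)) (⟪⟫-⊗ (P-exponents n) (∏P-exponents ns))

-- This is the recursion that words obey inside a component: either the first pure column is a one,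
-- or all n + 1 pure columns are twos.
P-exponents-suc : ∀ n →
  P-exponents (suc n) ≡ map ((1 , 0) ∔_) (P-exponents n) ++ (0 , suc n) ∷ []
P-exponents-suc n = begin
  map f (upTo (suc (suc n)))                  ≡⟨ cong (map f) (sym (List.applyUpTo-∷ʳ id (suc n))) ⟩
  map f (upTo (suc n) ++ suc n ∷ [])          ≡⟨ List.map-++ f (upTo (suc n)) _ ⟩
  map f (upTo (suc n)) ++ (n ∸ n , suc n) ∷ []
    ≡⟨ cong₂ (λ xs m → xs ++ (m , suc n) ∷ []) init≡ (ℕ.n∸n≡0 n) ⟩
  map ((1 , 0) ∔_) (P-exponents n) ++ (0 , suc n) ∷ [] ∎
  where
  open ≡-Reasoning
  f : ℕ → Exponent
  f i = suc n ∸ i , i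
  init≡ : map f (upTo (suc n)) ≡ map ((1 , 0) ∔_) (P-exponents n)
  init≡ = trans
    (List.map-cong-local (All.map (λ {i} i<1+n → cong (_, i) (ℕ.+-∸-assoc 1 (ℕ.≤-pred i<1+n)))
      (All.all-upTo (suc n))))
    (List.map-∘ (upTo (suc n)))

∔-assoc : ∀ e f g → (e ∔ f) ∔ g ≡ e ∔ (f ∔ g)
∔-assoc (a , b) (c , d) (a′ , b′) = cong₂ _,_ (ℕ.+-assoc a c a′) (ℕ.+-assoc b d b′)

⊛-++ : ∀ es es′ fs → (es ++ es′) ⊛ fs ≡ es ⊛ fs ++ es′ ⊛ fs
⊛-++ []       es′ fs = refl
⊛-++ (e ∷ es) es′ fs = trans (cong (map (e ∔_) fs ++_) (⊛-++ es es′ fs))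
  (sym (List.++-assoc (map (e ∔_) fs) _ _))

map-⊛ : ∀ e es fs → map (e ∔_) es ⊛ fs ≡ map (e ∔_) (es ⊛ fs)
map-⊛ e []       fs = refl
map-⊛ e (f ∷ es) fs = sym (trans (List.map-++ (e ∔_) (map (f ∔_) fs) _)
  (cong₂ _++_
    (trans (sym (List.map-∘ fs)) (List.map-cong (λ g → sym (∔-assoc e f g)) fs))
    (sym (map-⊛ e es fs))))

-- Words of column types

data Letter : Set where
  one two star : Letter

-- A mixed column contributes x₁x₂ to the monomial. These factors make up the M-th power of x₁x₂,
-- which `ircont-weight` splits off, so a star weighs nothing here.
letterWeight : Letter → Exponent
letterWeight one  = 1 , 0
letterWeight two  = 0 , 1
letterWeight star = 0 , 0

weight : List Letter → Exponent
weight []      = 0 , 0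
weight (l ∷ w) = letterWeight l ∔ weight w

when : {A B : Set} → Dec A → List B → List B
when (yes _) xs = xs
when (no _)  _  = []

module _ {A B : Set} where

  when-yes : (a? : Dec A) {xs : List B} → A → when a? xs ≡ xs
  when-yes (yes _) _ = refl
  when-yes (no ¬a) a = contradiction a ¬a

  when-no : (a? : Dec A) {xs : List B} → ¬ A → when a? xs ≡ []
  when-no (yes a) ¬a = contradiction a ¬a
  when-no (no _)  _  = refl

  when-[] : (a? : Dec A) {xs : List B} → xs ≡ [] → when a? xs ≡ []
  when-[] (yes _) e = e
  when-[] (no _)  _ = refl

  ∈-when⁺ : (a? : Dec A) {xs : List B} {x : B} → A → x ∈ˡ xs → x ∈ˡ when a? xs
  ∈-when⁺ (yes _) _ x∈ = x∈
  ∈-when⁺ (no ¬a) a _  = contradiction a ¬a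

  ∈-when⁻ : (a? : Dec A) {xs : List B} {x : B} → x ∈ˡ when a? xs → A × x ∈ˡ xs
  ∈-when⁻ (yes a) x∈ = a , x∈

  map-when : {C : Set} (f : B → C) (a? : Dec A) (xs : List B) → map f (when a? xs) ≡ when a? (map f xs)
  map-when f (yes _) xs = refl
  map-when f (no _)  xs = refl

  unique-when : (a? : Dec A) {xs : List B} → Unique xs → Unique (when a? xs)
  unique-when (yes _) u = u
  unique-when (no _)  _ = []

all-out⇒[] : {A : Set} {xs : List A} → (∀ {x} → ¬ x ∈ˡ xs) → xs ≡ []
all-out⇒[] {xs = []}     _ = refl
all-out⇒[] {xs = x ∷ xs} f = contradiction (here refl) f

-- Valid d x α p w: the letters of w describe the d columns x, x+1, …; there are α mixed columns
-- to the left of x, and p says whether column x − 1 is pure 2.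
module Words (s : ℕ) (L U : ℕ → ℕ) where

  data Valid : (d x α : ℕ) → Bool → List Letter → Set where
    end  : ∀ {x α p} → α ≡ s → Valid 0 x α p []
    one  : ∀ {d x α w} → α ≡ U x → Valid d (suc x) α false w →
           Valid (suc d) x α false (one ∷ w)
    two  : ∀ {d x α p w} → α ≡ L (suc x) → Valid d (suc x) α true w →
           Valid (suc d) x α p (two ∷ w)
    star : ∀ {d x α p w} → U x ≤ α → suc α ≤ L (suc x) → Valid d (suc x) (suc α) false w →
           Valid (suc d) x α p (star ∷ w)

  one? : ∀ x α p → Dec (p ≡ false × α ≡ U x)
  one? x α p = p Bool.≟ false ×-dec α ≟ U x

  star? : ∀ x α → Dec (U x ≤ α × suc α ≤ L (suc x))
  star? x α = U x ≤? α ×-dec suc α ≤? L (suc x)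

  -- The branches star and two are adjacent because `stars-twos` treats them together, after the
  -- branch one has been excluded or split off.
  words : (d x α : ℕ) → Bool → List (List Letter)
  words zero    x α p = when (α ≟ s) ([] ∷ [])
  words (suc d) x α p =
       when (one? x α p)        (map (one ∷_)  (words d (suc x) α false))
    ++ when (star? x α)         (map (star ∷_) (words d (suc x) (suc α) false))
    ++ when (α ≟ L (suc x))     (map (two ∷_)  (words d (suc x) α true))

  words-complete : ∀ {d x α p w} → Valid d x α p w → w ∈ˡ words d x α p
  words-complete {x = x} {α} (end e) = ∈-when⁺ (α ≟ s) e (here refl)
  words-complete {suc d} {x} {α} (one e v) =
    ∈-++⁺ˡ (∈-when⁺ (one? x α false) (refl , e) (∈-map⁺ (one ∷_) (words-complete v)))
  words-complete {suc d} {x} {α} {p} (two e v) =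
    ∈-++⁺ʳ (when (one? x α p) _) (∈-++⁺ʳ (when (star? x α) _)
      (∈-when⁺ (α ≟ L (suc x)) e (∈-map⁺ (two ∷_) (words-complete v))))
  words-complete {suc d} {x} {α} {p} (star e e′ v) =
    ∈-++⁺ʳ (when (one? x α p) _) (∈-++⁺ˡ
      (∈-when⁺ (star? x α) (e , e′) (∈-map⁺ (star ∷_) (words-complete v))))

  words-sound : ∀ d {x α p w} → w ∈ˡ words d x α p → Valid d x α p w
  words-sound zero {x} {α} w∈ with ∈-when⁻ (α ≟ s) w∈
  ... | e , here refl = end e
  words-sound (suc d) {x} {α} {p} w∈ with ∈-++⁻ (when (one? x α p) _) w∈
  ... | inj₁ w∈₁ with ∈-when⁻ (one? x α p) w∈₁
  ...   | (refl , e) , w∈′ with ∈-map⁻ (one ∷_) w∈′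
  ...     | _ , v∈ , refl = one e (words-sound d v∈)
  words-sound (suc d) {x} {α} {p} w∈ | inj₂ w∈₂ with ∈-++⁻ (when (star? x α) _) w∈₂
  ... | inj₁ w∈₁ with ∈-when⁻ (star? x α) w∈₁
  ...   | (e , e′) , w∈′ with ∈-map⁻ (star ∷_) w∈′
  ...     | _ , v∈ , refl = star e e′ (words-sound d v∈)
  words-sound (suc d) {x} {α} {p} w∈ | inj₂ _ | inj₂ w∈₃ with ∈-when⁻ (α ≟ L (suc x)) w∈₃
  ... | e , w∈′ with ∈-map⁻ (two ∷_) w∈′
  ...   | _ , v∈ , refl = two e (words-sound d v∈)

  words-unique : ∀ d x α p → Unique (words d x α p)
  words-unique zero    x α p = unique-when (α ≟ s) (All.[] ∷ [])
  words-unique (suc d) x α p =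
    Unique.++⁺ (unique-when (one? x α p) (u one))
      (Unique.++⁺ (unique-when (star? x α) (u star)) (unique-when (α ≟ L (suc x)) (u two)) disjoint₂)
      disjoint₁
    where
    u : ∀ l {β q} → Unique (map (l ∷_) (words d (suc x) β q))
    u l = Unique.map⁺ List.∷-injectiveʳ (words-unique d (suc x) _ _)
    disjoint₂ : ∀ {w} → ¬ (w ∈ˡ when (star? x α) _ × w ∈ˡ when (α ≟ L (suc x)) _)
    disjoint₂ (w∈ , w∈′) with ∈-map⁻ (star ∷_) (proj₂ (∈-when⁻ (star? x α) w∈))
                            | ∈-map⁻ (two ∷_) (proj₂ (∈-when⁻ (α ≟ L (suc x)) w∈′))
    ... | _ , _ , refl | _ , _ , ()
    disjoint₁ : ∀ {w} → ¬ (w ∈ˡ when (one? x α p) _ × w ∈ˡ when (star? x α) _ ++ when (α ≟ L (suc x)) _)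
    disjoint₁ (w∈ , w∈′) with ∈-map⁻ (one ∷_) (proj₂ (∈-when⁻ (one? x α p) w∈))
                            | ∈-++⁻ (when (star? x α) _) w∈′
    ... | _ , _ , refl | inj₁ w∈₁ with ∈-map⁻ (star ∷_) (proj₂ (∈-when⁻ (star? x α) w∈₁))
    ...   | _ , _ , ()
    disjoint₁ (w∈ , w∈′) | _ , _ , refl | inj₂ w∈₂
      with ∈-map⁻ (two ∷_) (proj₂ (∈-when⁻ (α ≟ L (suc x)) w∈₂))
    ...   | _ , _ , ()

-- Lattice paths between lo and hi

∸-suc : ∀ {x b} → x < b → b ∸ x ≡ suc (b ∸ suc x)
∸-suc (s≤s x≤b) = ℕ.+-∸-assoc 1 x≤b

≤⇒+ : ∀ {m n} → m ≤ n → ∃ λ k → k + m ≡ n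
≤⇒+ m≤n = _ , ℕ.m∸n+n≡m m≤n

module Paths (W s : ℕ) (L U : ℕ → ℕ)
  (L-mono : ∀ x → L x ≤ L (suc x)) (U-mono : ∀ x → U x ≤ U (suc x))
  (L₁ : L 1 ≡ 0) (Uₑ : U (suc W) ≡ s) (L≤s : ∀ x → L x ≤ s)
  (hall : ∀ a b → 1 ≤ a → a ≤ b → b ≤ suc W → U b ≤ L a + (b ∸ a))
  where

  open Words s L U public

  -- lo x ≤ α ≤ hi x for every rpp; hi is attained by placing the mixed columns as far to the
  -- left as possible, lo by placing them as far to the right as possible.
  hi : ℕ → ℕ
  hi zero    = 0
  hi (suc x) = L (suc x) ⊓ suc (hi x)

  -- The path is determined from the right end, so the recursion is on the number d of columns that
  -- remain. Truncation in `∸ 1` does no harm, as the maximum with `U x` is taken.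
  lo-from : ℕ → ℕ → ℕ
  lo-from zero    x = U x
  lo-from (suc d) x = U x ⊔ (lo-from d (suc x) ∸ 1)

  lo : ℕ → ℕ
  lo x = lo-from (suc W ∸ x) x

  lo-end : lo (suc W) ≡ s
  lo-end rewrite ℕ.n∸n≡0 W = Uₑ

  lo-step : ∀ {x} → x ≤ W → lo x ≡ U x ⊔ (lo (suc x) ∸ 1)
  lo-step x≤W rewrite ℕ.+-∸-assoc 1 x≤W = refl

  hi≤L : ∀ x → hi x ≤ L x
  hi≤L zero    = z≤n
  hi≤L (suc x) = ℕ.m⊓n≤m _ _

  hi-mono : ∀ x → hi x ≤ hi (suc x)
  hi-mono x = ℕ.⊓-glb (ℕ.≤-trans (hi≤L x) (L-mono x)) (ℕ.n≤1+n _)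

  hi-suc : ∀ x → hi (suc x) ≤ suc (hi x)
  hi-suc x = ℕ.m⊓n≤n (L (suc x)) _

  hi-+ : ∀ n x → hi (n + x) ≤ n + hi x
  hi-+ zero    x = ℕ.≤-refl
  hi-+ (suc n) x = ℕ.≤-trans (hi-suc (n + x)) (s≤s (hi-+ n x))

  hi₁ : hi 1 ≡ 0
  hi₁ = ℕ.n≤0⇒n≡0 (subst (hi 1 ≤_) L₁ (hi≤L 1))

  U≤lo : ∀ {x} → x ≤ suc W → U x ≤ lo x
  U≤lo {x} x≤ with ℕ.m≤n⇒m<n∨m≡n x≤
  ... | inj₁ (s≤s x≤W) = subst (U x ≤_) (sym (lo-step x≤W)) (ℕ.m≤m⊔n _ _)
  ... | inj₂ refl      = ℕ.≤-reflexive (trans Uₑ (sym lo-end))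

  lo-suc : ∀ {x} → x ≤ W → lo (suc x) ≤ suc (lo x)
  lo-suc {x} x≤W = ℕ.≤-trans (ℕ.m≤n+m∸n (lo (suc x)) 1)
    (s≤s (subst (lo (suc x) ∸ 1 ≤_) (sym (lo-step x≤W)) (ℕ.m≤n⊔m (U x) _)))

  lo-mono : ∀ {x} → x ≤ W → lo x ≤ lo (suc x)
  lo-mono {x} x≤W = subst (_≤ lo (suc x)) (sym (lo-step x≤W))
    (ℕ.⊔-lub (ℕ.≤-trans (U-mono x) (U≤lo (s≤s x≤W))) (ℕ.m∸n≤m _ 1))

  lo-+ : ∀ n {x} → n + x ≤ suc W → lo (n + x) ≤ n + lo x
  lo-+ zero    _        = ℕ.≤-refl
  lo-+ (suc n) (s≤s n+x≤W) =
    ℕ.≤-trans (lo-suc n+x≤W) (s≤s (lo-+ n (ℕ.m≤n⇒m≤1+n n+x≤W)))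

  -- Where `hi` follows `L`, the Hall inequality with this left end applies directly; where it rises
  -- by one, the bound is inherited from the previous column.
  U≤hi : ∀ x b → suc x ≤ b → b ≤ suc W → U b ≤ hi (suc x) + (b ∸ suc x)
  U≤hi zero b 0<b b≤ =
    subst (λ z → U b ≤ z + (b ∸ 1)) (trans L₁ (sym hi₁)) (hall 1 b ℕ.≤-refl 0<b b≤)
  U≤hi (suc x) b x<b b≤ with ℕ.⊓-sel (L (suc (suc x))) (suc (hi (suc x)))
  ... | inj₁ e =
    subst (λ z → U b ≤ z + (b ∸ suc (suc x))) (sym e) (hall (suc (suc x)) b (s≤s z≤n) x<b b≤)
  ... | inj₂ e = subst (λ z → U b ≤ z + (b ∸ suc (suc x))) (sym e) (begin
    U b                                  ≤⟨ U≤hi x b (ℕ.<⇒≤ x<b) b≤ ⟩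
    hi (suc x) + (b ∸ suc x)             ≡⟨ cong (hi (suc x) +_) (∸-suc x<b) ⟩
    hi (suc x) + suc (b ∸ suc (suc x))   ≡⟨ ℕ.+-suc (hi (suc x)) _ ⟩
    suc (hi (suc x)) + (b ∸ suc (suc x)) ∎)
    where open ℕ.≤-Reasoning

  lo-from≤ : ∀ d x h → (∀ b → x ≤ b → b ≤ d + x → U b ≤ h + (b ∸ x)) → lo-from d x ≤ h
  lo-from≤ zero    x h bound =
    subst (U x ≤_) (trans (cong (h +_) (ℕ.n∸n≡0 x)) (ℕ.+-identityʳ h)) (bound x ℕ.≤-refl ℕ.≤-refl)
  lo-from≤ (suc d) x h bound = ℕ.⊔-lub
    (subst (U x ≤_) (trans (cong (h +_) (ℕ.n∸n≡0 x)) (ℕ.+-identityʳ h))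
      (bound x ℕ.≤-refl (ℕ.m≤n+m x (suc d))))
    (ℕ.m≤n+o⇒m∸n≤o _ 1 (lo-from≤ d (suc x) (suc h) λ b x<b b≤ →
      subst (U b ≤_) (trans (cong (h +_) (∸-suc x<b)) (ℕ.+-suc h _))
        (bound b (ℕ.<⇒≤ x<b) (subst (b ≤_) (ℕ.+-suc d x) b≤))))

  lo≤hi : ∀ {x} → 1 ≤ x → x ≤ suc W → lo x ≤ hi x
  lo≤hi {suc x} _ x≤ = lo-from≤ (suc W ∸ suc x) (suc x) (hi (suc x))
    λ b x≤b b≤ → U≤hi x b x≤b (subst (b ≤_) (ℕ.m∸n+n≡m x≤) b≤)

  -- Induction from the right end, where α = s = lo. Its use is pruning: a state below `lo` has no
  -- completion (`weights-dead`).
  lo-valid : ∀ {d x α p w} → Valid d x α p w → d + x ≡ suc W → lo x ≤ α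
  lo-valid (end α≡s) refl = ℕ.≤-reflexive (trans lo-end (sym α≡s))
  lo-valid {x = x} (one α≡U v) d+x = subst (_≤ _) (sym (lo-step x≤W))
    (ℕ.⊔-lub (ℕ.≤-reflexive (sym α≡U)) (ℕ.≤-trans (ℕ.m∸n≤m _ 1)
      (lo-valid v (trans (ℕ.+-suc _ x) d+x))))
    where x≤W = ℕ.≤-trans (ℕ.m≤n+m x _) (ℕ.≤-reflexive (ℕ.suc-injective d+x))
  lo-valid {x = x} (two α≡L v) d+x = ℕ.≤-trans (lo-mono x≤W)
    (lo-valid v (trans (ℕ.+-suc _ x) d+x))
    where x≤W = ℕ.≤-trans (ℕ.m≤n+m x _) (ℕ.≤-reflexive (ℕ.suc-injective d+x))
  lo-valid {x = x} (star U≤α _ v) d+x = subst (_≤ _) (sym (lo-step x≤W))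
    (ℕ.⊔-lub U≤α (ℕ.m≤n+o⇒m∸n≤o _ 1 (lo-valid v (trans (ℕ.+-suc _ x) d+x))))
    where x≤W = ℕ.≤-trans (ℕ.m≤n+m x _) (ℕ.≤-reflexive (ℕ.suc-injective d+x))

  -- Exponents of all completions of a partial path.

  weights : (x α : ℕ) → Bool → List Exponent
  weights x α p = map weight (words (suc W ∸ x) x α p)

  weights-dead : ∀ {x α p} → x ≤ suc W → α < lo x → weights x α p ≡ []
  weights-dead {x} x≤ α<lo = cong (map weight) (all-out⇒[] λ w∈ →
    ℕ.<⇒≱ α<lo (lo-valid (words-sound (suc W ∸ x) w∈) (ℕ.m∸n+n≡m x≤)))

  ones stars twos : (x α : ℕ) → Bool → List Exponent
  ones  x α p = when (one? x α p) (map ((1 , 0) ∔_) (weights (suc x) α false))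
  stars x α p = when (star? x α) (weights (suc x) (suc α) false)
  twos  x α p = when (α ≟ L (suc x)) (map ((0 , 1) ∔_) (weights (suc x) α true))

  weights-step : ∀ {x} → x ≤ W → ∀ α p →
    weights x α p ≡ ones x α p ++ stars x α p ++ twos x α p
  weights-step {x} x≤W α p rewrite ℕ.+-∸-assoc 1 x≤W = begin
    map weight (when (one? x α p) (ws one) ++ when (star? x α) (ws star) ++ when (α ≟ L (suc x)) (ws two))
      ≡⟨ List.map-++ weight (when (one? x α p) (ws one)) _ ⟩
    map weight (when (one? x α p) (ws one)) ++
    map weight (when (star? x α) (ws star) ++ when (α ≟ L (suc x)) (ws two))
      ≡⟨ cong (map weight (when (one? x α p) (ws one)) ++_) (List.map-++ weight (when (star? x α) (ws star)) _) ⟩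
    map weight (when (one? x α p) (ws one)) ++ map weight (when (star? x α) (ws star))
      ++ map weight (when (α ≟ L (suc x)) (ws two))
      ≡⟨ cong₂ _++_ (branch (one? x α p) one) (cong₂ _++_ (branch (star? x α) star) (branch (α ≟ L (suc x)) two)) ⟩
    ones x α p ++ when (star? x α) (map ((0 , 0) ∔_) (weights (suc x) (suc α) false)) ++ twos x α p
      ≡⟨ cong (λ es → ones x α p ++ when (star? x α) es ++ twos x α p) (List.map-id _) ⟩
    ones x α p ++ stars x α p ++ twos x α p ∎
    where
    open ≡-Reasoning
    next : Letter → ℕ × Bool
    next one  = α , false
    next two  = α , true
    next star = suc α , false
    rest : Letter → List (List Letter)
    rest l = words (W ∸ x) (suc x) (proj₁ (next l)) (proj₂ (next l))
    ws : Letter → List (List Letter)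
    ws l = map (l ∷_) (rest l)
    branch : {A : Set} (a? : Dec A) (l : Letter) →
      map weight (when a? (ws l)) ≡ when a? (map (letterWeight l ∔_) (map weight (rest l)))
    branch a? l = trans (map-when weight a? (ws l))
      (cong (when a?) (trans (sym (List.map-∘ (rest l))) (List.map-∘ (rest l))))

  -- A one or a two would leave α at `hi x`, which is below `lo (suc x)`, so only a star survives.
  -- The flag p is forgotten on the right: a two before the covered column does not restrict what
  -- comes after it.
  weights-covered : ∀ {x} p → 1 ≤ x → x ≤ W → hi x < lo (suc x) →
    weights x (hi x) p ≡ weights (suc x) (hi (suc x)) false
  weights-covered {x} p 1≤x x≤W hi<lo = begin
    weights x α p                                  ≡⟨ weights-step x≤W α p ⟩
    ones x α p ++ stars x α p ++ twos x α p
      ≡⟨ cong₂ _++_ (when-[] (one? x α p) (cong (map _) dead)) (cong₂ _++_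
           (when-yes (star? x α) (ℕ.≤-trans (U≤lo (ℕ.m≤n⇒m≤1+n x≤W)) (lo≤hi 1≤x (ℕ.m≤n⇒m≤1+n x≤W))
             , subst (_≤ L (suc x)) hi-next (hi≤L (suc x))))
           (when-[] (α ≟ L (suc x)) (cong (map _) dead))) ⟩
    weights (suc x) (suc α) false ++ []            ≡⟨ List.++-identityʳ _ ⟩
    weights (suc x) (suc α) false                  ≡⟨ cong (λ β → weights (suc x) β false) (sym hi-next) ⟩
    weights (suc x) (hi (suc x)) false             ∎
    where
    open ≡-Reasoning
    α = hi x
    dead : ∀ {q} → weights (suc x) α q ≡ []
    dead = weights-dead (s≤s x≤W) hi<lo
    hi-next : hi (suc x) ≡ suc (hi x)
    hi-next = ℕ.≤-antisym (hi-suc x) (ℕ.≤-trans hi<lo (lo≤hi (s≤s z≤n) (s≤s x≤W)))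

  weights-covered-run : ∀ n {x} p → 1 ≤ x → suc n + x ≤ suc W →
    (∀ y → x ≤ y → y ≤ n + x → hi y < lo (suc y)) →
    weights x (hi x) p ≡ weights (suc n + x) (hi (suc n + x)) false
  weights-covered-run zero    {x} p 1≤x (s≤s x≤W) cov = weights-covered p 1≤x x≤W (cov x ℕ.≤-refl ℕ.≤-refl)
  weights-covered-run (suc n) {x} p 1≤x (s≤s n+x≤W) cov = trans
    (weights-covered-run n p 1≤x (ℕ.m≤n⇒m≤1+n n+x≤W) (λ y x≤y y≤ → cov y x≤y (ℕ.m≤n⇒m≤1+n y≤)))
    (weights-covered false (s≤s z≤n) n+x≤W
      (cov _ (ℕ.m≤n+m x (suc n)) ℕ.≤-refl))

  -- The column z is the end of a component, and `R` lists the exponents of everything from z on.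
  -- `R` has to be the same for both flags, so that the last letter of the component does not
  -- matter.
  module Block (z : ℕ) (z≤ : z ≤ suc W) (lo≡hi : lo z ≡ hi z) (R : List Exponent)
    (R↭ : ∀ p → weights z (hi z) p ↭ R) where

    no-gaps : ∀ {α ρ} → α ≡ hi z + ρ → α ≤ hi z → ρ ≡ 0
    no-gaps {ρ = ρ} refl α≤ = ℕ.n≤0⇒n≡0 (ℕ.+-cancelˡ-≤ (hi z) ρ 0
      (ℕ.≤-trans α≤ (ℕ.≤-reflexive (sym (ℕ.+-identityʳ _)))))

    -- ρ is the number of pure columns still to come; after a pure 2, or once α exceeds lo,
    -- all of them must be pure 2's.
    weights-2s : ∀ n {x α p ρ} → n + x ≡ z → n + α ≡ hi z + ρ → 1 ≤ x →
      (∀ y → x ≤ y → y < z → lo (suc y) ≤ hi y) → lo x ≤ α → α ≤ hi x →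
      (lo x < α) ⊎ (p ≡ true × α ≡ hi x) →
      weights x α p ↭ map ((0 , ρ) ∔_) R

    -- The path is forced towards `hi`: below `L (suc x)` only a star is admissible, and at
    -- `L (suc x)` only a two.
    stars-twos : ∀ n {x α p ρ} → suc n + x ≡ z → suc n + α ≡ hi z + ρ → 1 ≤ x →
      (∀ y → x ≤ y → y < z → lo (suc y) ≤ hi y) → lo x ≤ α → α ≤ hi x → lo (suc x) ≤ α →
      stars x α p ++ twos x α p ↭ map ((0 , ρ) ∔_) R

    x≤W : ∀ n {x} → suc n + x ≡ z → x ≤ W
    x≤W n {x} refl = ℕ.≤-trans (ℕ.m≤n+m x n) (ℕ.≤-pred z≤)

    weights-2s zero refl α≡ 1≤x unc lo≤α α≤hi _
      with refl ← no-gaps α≡ α≤hi with refl ← trans α≡ (ℕ.+-identityʳ _) =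
      ↭-trans (R↭ _) (↭-reflexive (sym (List.map-id R)))
    weights-2s (suc n) {x} {α} {p} nx α≡ 1≤x unc lo≤α α≤hi c =
      ↭-trans (↭-reflexive (trans (weights-step (x≤W n nx) α p)
          (cong (_++ stars x α p ++ twos x α p) (when-no (one? x α p) (no-one c)))))
        (stars-twos n {p = p} nx α≡ 1≤x unc lo≤α α≤hi (next c))
      where
      no-one : (lo x < α) ⊎ (p ≡ true × α ≡ hi x) → ¬ (p ≡ false × α ≡ U x)
      no-one (inj₁ lo<α) (_ , α≡U) =
        ℕ.<⇒≱ lo<α (subst (_≤ lo x) (sym α≡U) (U≤lo (ℕ.m≤n⇒m≤1+n (x≤W n nx))))
      no-one (inj₂ (refl , _)) (() , _)
      next : (lo x < α) ⊎ (p ≡ true × α ≡ hi x) → lo (suc x) ≤ α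
      next (inj₁ lo<α)     = ℕ.≤-trans (lo-suc (x≤W n nx)) lo<α
      next (inj₂ (_ , e)) = subst (lo (suc x) ≤_) (sym e)
        (unc x ℕ.≤-refl (subst (x <_) nx (s≤s (ℕ.m≤n+m x n))))

    stars-twos n {x} {α} {p} {ρ} nx α≡ 1≤x unc lo≤α α≤hi lo′≤α with ℕ.≤-<-connex (L (suc x)) α
    ... | inj₂ α<L = ↭-trans
      (↭-reflexive (trans (cong₂ _++_
          (when-yes (star? x α) (ℕ.≤-trans (U≤lo (ℕ.m≤n⇒m≤1+n (x≤W n nx))) lo≤α , α<L))
          (when-no (α ≟ L (suc x)) (ℕ.<⇒≢ α<L)))
        (List.++-identityʳ _)))
      (weights-2s n (trans (ℕ.+-suc n x) nx) (trans (ℕ.+-suc n α) α≡) (s≤s z≤n)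
        (λ y x<y → unc y (ℕ.<⇒≤ x<y)) (ℕ.m≤n⇒m≤1+n lo′≤α) (ℕ.⊓-glb α<L (s≤s α≤hi))
        (inj₁ (s≤s lo′≤α)))
    ... | inj₁ L≤α = aux α≡
      where
      α≡L : α ≡ L (suc x)
      α≡L = ℕ.≤-antisym (ℕ.≤-trans α≤hi (ℕ.≤-trans (hi-mono x) (hi≤L (suc x)))) L≤α
      α≡hi : α ≡ hi (suc x)
      α≡hi = ℕ.≤-antisym (ℕ.≤-trans α≤hi (hi-mono x)) (subst (hi (suc x) ≤_) (sym α≡L) (hi≤L (suc x)))
      nx′ : n + suc x ≡ z
      nx′ = trans (ℕ.+-suc n x) nx
      aux : ∀ {ρ} → suc n + α ≡ hi z + ρ → stars x α p ++ twos x α p ↭ map ((0 , ρ) ∔_) R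
      -- With no pure column left, a two at x would leave n columns for a climb of n + 1 from
      -- `hi (suc x)` to `hi z`, but `hi` gains at most one per column.
      aux {zero} e = contradiction (hi-+ n (suc x)) (ℕ.<⇒≱
        (ℕ.≤-reflexive (trans (cong (λ β → suc (n + β)) (sym α≡hi))
          (trans e (trans (ℕ.+-identityʳ _) (cong hi (sym nx′)))))))
      aux {suc ρ} e = ↭-trans
        (↭-reflexive (cong₂ _++_
          (when-no (star? x α) (λ (_ , α<L) → ℕ.<⇒≱ α<L L≤α))
          (when-yes (α ≟ L (suc x)) α≡L)))
        (↭-trans (map⁺ ((0 , 1) ∔_) (weights-2s n {ρ = ρ} nx′
            (ℕ.suc-injective (trans e (ℕ.+-suc (hi z) ρ))) (s≤s z≤n)
            (λ y x<y → unc y (ℕ.<⇒≤ x<y)) lo′≤α (ℕ.≤-reflexive α≡hi) (inj₂ (refl , α≡hi))))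
          (↭-reflexive (sym (List.map-∘ R))))

    -- Where `lo` rises, every letter other than star falls below it, so a star is forced. Where
    -- `lo` is flat, it equals `U x`, and there is a choice: a one keeps the path on `lo`, while a
    -- star or a two excludes ones for the rest of the component. The two alternatives are the two
    -- summands of `P-exponents-suc`.
    weights-P : ∀ n {x ρ} → n + x ≡ z → n + lo x ≡ hi z + ρ → 1 ≤ x →
      (∀ y → x ≤ y → y < z → lo (suc y) ≤ hi y) →
      weights x (lo x) false ↭ P-exponents ρ ⊛ R
    weights-P zero {ρ = ρ} refl α≡ _ _
      with refl ← no-gaps {ρ = ρ} α≡ (ℕ.≤-reflexive lo≡hi) =
      ↭-trans (↭-reflexive (cong (λ α → weights z α false) lo≡hi))
        (↭-trans (R↭ false)
          (↭-reflexive (sym (trans (List.++-identityʳ _) (List.map-id R)))))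
    weights-P (suc n) {x} {ρ} nx α≡ 1≤x unc with ℕ.≤-<-connex (lo (suc x)) (lo x)
    ... | inj₂ lo< = ↭-trans
      (↭-reflexive (begin
        weights x α false                           ≡⟨ weights-step (x≤W n nx) α false ⟩
        ones x α false ++ stars x α false ++ twos x α false
          ≡⟨ cong₂ _++_ (when-[] (one? x α false) (cong (map _) dead)) (cong₂ _++_
               (when-yes (star? x α) (U≤lo (ℕ.m≤n⇒m≤1+n (x≤W n nx)) ,
                 ℕ.≤-trans lo< (ℕ.≤-trans (unc x ℕ.≤-refl x<z) (ℕ.≤-trans (hi-mono x) (hi≤L (suc x))))))
               (when-[] (α ≟ L (suc x)) (cong (map _) dead))) ⟩
        weights (suc x) (suc α) false ++ []         ≡⟨ List.++-identityʳ _ ⟩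
        weights (suc x) (suc α) false               ≡⟨ cong (λ β → weights (suc x) β false) lo-next ⟩
        weights (suc x) (lo (suc x)) false          ∎))
      (weights-P n (trans (ℕ.+-suc n x) nx)
        (trans (cong (n +_) (sym lo-next)) (trans (ℕ.+-suc n α) α≡)) (s≤s z≤n)
        (λ y x<y → unc y (ℕ.<⇒≤ x<y)))
      where
      open ≡-Reasoning
      α = lo x
      x<z : x < z
      x<z = subst (x <_) nx (s≤s (ℕ.m≤n+m x n))
      dead : ∀ {q} → weights (suc x) α q ≡ []
      dead = weights-dead (s≤s (x≤W n nx)) lo<
      lo-next : suc α ≡ lo (suc x)
      lo-next = ℕ.≤-antisym lo< (lo-suc (x≤W n nx))
    ... | inj₁ lo′≤ = aux α≡
      where
      α = lo x
      x≤W′ = x≤W n nx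
      α≤hi : α ≤ hi x
      α≤hi = lo≤hi 1≤x (ℕ.m≤n⇒m≤1+n x≤W′)
      lo-next : lo (suc x) ≡ α
      lo-next = ℕ.≤-antisym lo′≤ (lo-mono x≤W′)
      nx′ : n + suc x ≡ z
      nx′ = trans (ℕ.+-suc n x) nx
      α≡U : α ≡ U x
      α≡U with ℕ.⊔-sel (U x) (lo (suc x) ∸ 1)
      ... | inj₁ e = trans (lo-step x≤W′) e
      -- Here `lo x` equals its own truncated predecessor, hence is 0.
      ... | inj₂ e = ℕ.≤-antisym (subst (_≤ U x) (sym α≡0) z≤n) (U≤lo (ℕ.m≤n⇒m≤1+n x≤W′))
        where
        pred-fixed : ∀ m → m ≡ m ∸ 1 → m ≡ 0
        pred-fixed zero    _ = refl
        pred-fixed (suc m) e = contradiction e (ℕ.1+n≢n)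
        α≡0 : α ≡ 0
        α≡0 = pred-fixed α (trans (trans (lo-step x≤W′) e) (cong (_∸ 1) lo-next))
      aux : ∀ {ρ} → suc n + α ≡ hi z + ρ → weights x α false ↭ P-exponents ρ ⊛ R
      -- With no pure column left, `lo` would have to gain n + 1 over n columns.
      aux {zero} e = contradiction (lo-+ n (ℕ.≤-trans (ℕ.≤-reflexive nx′) z≤)) (ℕ.<⇒≱
        (ℕ.≤-reflexive (trans (cong (λ β → suc (n + β)) lo-next)
          (trans e (trans (ℕ.+-identityʳ _) (trans (sym lo≡hi) (cong lo (sym nx′))))))))
      aux {suc ρ} e = ↭-trans
        (↭-reflexive (trans (weights-step x≤W′ α false)
          (cong (_++ stars x α false ++ twos x α false) (when-yes (one? x α false) (refl , α≡U)))))
        (↭-trans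
          (++⁺ (map⁺ ((1 , 0) ∔_) (↭-trans
                 (↭-reflexive (cong (λ β → weights (suc x) β false) (sym lo-next)))
                 (weights-P n {ρ = ρ} nx′ (trans (cong (n +_) lo-next)
                   (ℕ.suc-injective (trans e (ℕ.+-suc (hi z) ρ)))) (s≤s z≤n)
                   (λ y x<y → unc y (ℕ.<⇒≤ x<y)))))
               (stars-twos n {p = false} nx e 1≤x unc ℕ.≤-refl α≤hi lo′≤))
          (↭-reflexive (sym (begin
            P-exponents (suc ρ) ⊛ R
              ≡⟨ cong (_⊛ R) (P-exponents-suc ρ) ⟩
            (map ((1 , 0) ∔_) (P-exponents ρ) ++ (0 , suc ρ) ∷ []) ⊛ R
              ≡⟨ ⊛-++ (map ((1 , 0) ∔_) (P-exponents ρ)) _ R ⟩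
            map ((1 , 0) ∔_) (P-exponents ρ) ⊛ R ++ map ((0 , suc ρ) ∔_) R ++ []
              ≡⟨ cong₂ _++_ (map-⊛ (1 , 0) (P-exponents ρ) R) (List.++-identityʳ _) ⟩
            map ((1 , 0) ∔_) (P-exponents ρ ⊛ R) ++ map ((0 , suc ρ) ∔_) R ∎))))
        where open ≡-Reasoning

  -- Tight intervals and the chains they form.

  Tight : ℕ → ℕ → Set
  Tight a b = U b ≡ L a + (b ∸ a)

  -- The columns x lying in some tight interval are those with hi x < lo (suc x).
  Uncovered : ℕ → Set
  Uncovered x = lo (suc x) ≤ hi x

  -- A `TightSequence` in terms of `L` and `U`, with an arbitrary first column, so that one can be
  -- built from right to left.
  record Chain (start : ℕ) : Set where
    field
      r     : ℕ
      a b   : ℕ → ℕ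
      first : b 0 ≡ start
      last  : a (suc r) ≡ suc W
      b₀≤a₁ : b 0 ≤ a 1
      a<b   : ∀ k → 1 ≤ k → k ≤ r → a k < b k
      b<a   : ∀ k → 1 ≤ k → k < r → b k < a (suc k)
      bᵣ≤aᵣ₊₁ : b r ≤ a (suc r)
      tight : ∀ k → 1 ≤ k → k ≤ r → Tight (a k) (b k)

    b≤a : ∀ k → k ≤ r → b k ≤ a (suc k)
    b≤a zero    _   = b₀≤a₁
    b≤a (suc k) k<r with ℕ.m≤n⇒m<n∨m≡n k<r
    ... | inj₁ k+1<r = ℕ.<⇒≤ (b<a (suc k) (s≤s z≤n) k+1<r)
    ... | inj₂ k+1≡r = subst (λ j → b j ≤ a (suc j)) (sym k+1≡r) bᵣ≤aᵣ₊₁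

    start≤b : ∀ k → k ≤ r → start ≤ b k
    start≤b zero    _   = ℕ.≤-reflexive (sym first)
    start≤b (suc k) k<r = ℕ.≤-trans (start≤b k (ℕ.<⇒≤ k<r))
      (ℕ.≤-trans (b≤a k (ℕ.<⇒≤ k<r)) (ℕ.<⇒≤ (a<b (suc k) (s≤s z≤n) k<r)))

    start≤a : ∀ k → k ≤ r → start ≤ a (suc k)
    start≤a k k≤r = ℕ.≤-trans (start≤b k k≤r) (b≤a k k≤r)

    a≤end : ∀ m k → m + k ≡ r → a (suc k) ≤ suc W
    a≤end zero    k k≡r = ℕ.≤-reflexive (trans (cong (λ j → a (suc j)) k≡r) last)
    a≤end (suc m) k e = ℕ.≤-trans (ℕ.<⇒≤ (a<b (suc k) (s≤s z≤n) k<r))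
      (ℕ.≤-trans (b≤a (suc k) k<r) (a≤end m (suc k) (trans (ℕ.+-suc m k) e)))
      where k<r = subst (suc k ≤_) e (s≤s (ℕ.m≤n+m k m))

    a≤ : ∀ k → k ≤ r → a (suc k) ≤ suc W
    a≤ k k≤r = a≤end (r ∸ k) k (ℕ.m∸n+n≡m k≤r)

    b≤ : ∀ k → k ≤ r → b k ≤ suc W
    b≤ k k≤r = ℕ.≤-trans (b≤a k k≤r) (a≤ k k≤r)

    Support : ℕ → Set
    Support x = ∃ λ k → k ≤ r × b k ≤ x × x < a (suc k)

  module _ {a b : ℕ} (1≤a : 1 ≤ a) (b≤ : b ≤ suc W) (t : Tight a b) where

    -- From the left end, `hi y` is at most L a + (y - a); from the right end, `lo (suc y)` is at
    -- least U b - (b - (y + 1)). Tightness makes the second bound exceed the first by exactly one.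
    tight⇒covered : ∀ y → a ≤ y → y < b → hi y < lo (suc y)
    tight⇒covered y a≤y y<b
      with i , refl ← ≤⇒+ a≤y with j , refl ← ≤⇒+ y<b =
      ℕ.+-cancelˡ-≤ j _ _ (begin
        j + suc (hi (i + a))             ≤⟨ ℕ.+-monoʳ-≤ j (s≤s (ℕ.≤-trans (hi-+ i a) (ℕ.+-monoʳ-≤ i (hi≤L a)))) ⟩
        j + (suc i + L a)                ≡⟨ sym (ℕ.+-assoc j (suc i) (L a)) ⟩
        j + suc i + L a                  ≡⟨ ℕ.+-comm (j + suc i) (L a) ⟩
        L a + (j + suc i)                ≡⟨ cong (L a +_) (sym (ℕ.m+n∸n≡m (j + suc i) a)) ⟩
        L a + (j + suc i + a ∸ a)        ≡⟨ cong (λ e → L a + (e ∸ a)) (ℕ.+-assoc j (suc i) a) ⟩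
        L a + (j + suc (i + a) ∸ a)      ≡⟨ sym t ⟩
        U (j + suc (i + a))              ≤⟨ U≤lo b≤ ⟩
        lo (j + suc (i + a))             ≤⟨ lo-+ j b≤ ⟩
        j + lo (suc (i + a))             ∎)
      where open ℕ.≤-Reasoning

    -- Between a and b, `lo` gains at most b - a, and it has to reach U b = L a + (b - a). Since lo
    -- ≤ hi ≤ L, both paths meet at a; `tight-right` is the dual fact, that they meet at b.
    tight-left : a ≤ b → L a ≤ lo a
    tight-left a≤b = ℕ.+-cancelʳ-≤ (b ∸ a) _ _ (begin
      L a + (b ∸ a)        ≡⟨ sym t ⟩
      U b                  ≤⟨ U≤lo b≤ ⟩
      lo b                 ≡⟨ cong lo (sym (ℕ.m∸n+n≡m a≤b)) ⟩
      lo (b ∸ a + a)       ≤⟨ lo-+ (b ∸ a) (ℕ.≤-trans (ℕ.≤-reflexive (ℕ.m∸n+n≡m a≤b)) b≤) ⟩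
      b ∸ a + lo a         ≡⟨ ℕ.+-comm (b ∸ a) _ ⟩
      lo a + (b ∸ a)       ∎)
      where open ℕ.≤-Reasoning

    tight-right : a ≤ b → hi b ≤ U b
    tight-right a≤b = begin
      hi b                 ≡⟨ cong hi (sym (ℕ.m∸n+n≡m a≤b)) ⟩
      hi (b ∸ a + a)       ≤⟨ hi-+ (b ∸ a) a ⟩
      b ∸ a + hi a         ≤⟨ ℕ.+-monoʳ-≤ (b ∸ a) (hi≤L a) ⟩
      b ∸ a + L a          ≡⟨ ℕ.+-comm (b ∸ a) _ ⟩
      L a + (b ∸ a)        ≡⟨ sym t ⟩
      U b                  ∎
      where open ℕ.≤-Reasoning

  module _ (c : Chain 1) where
    open Chain c

    -- A column outside the support would lie in one of the tight intervals and so be covered. Hence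
    -- the uncovered columns lie in the support of every chain, which is the lower bound that
    -- minimality is measured against.
    uncovered⇒support : ∀ {y} → 1 ≤ y → y ≤ W → Uncovered y → Support y
    uncovered⇒support {y} 1≤y y≤W unc = go r 0 (ℕ.+-identityʳ r) (subst (_≤ y) (sym first) 1≤y)
      where
      go : ∀ m k → m + k ≡ r → b k ≤ y → Support y
      go m k e bk≤y with ℕ.≤-<-connex (a (suc k)) y
      go m       k e    bk≤y | inj₂ y<a = k , subst (k ≤_) e (ℕ.m≤n+m k m) , bk≤y , y<a
      go zero    k e    bk≤y | inj₁ a≤y = contradiction
        (ℕ.≤-trans (ℕ.≤-reflexive (sym (trans (cong (λ j → a (suc j)) e) last))) a≤y) (ℕ.<⇒≱ (s≤s y≤W))
      go (suc m) k e    bk≤y | inj₁ a≤y with ℕ.≤-<-connex (b (suc k)) y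
      ... | inj₁ b≤y = go m (suc k) (trans (ℕ.+-suc m k) e) b≤y
      ... | inj₂ y<b = contradiction unc (ℕ.<⇒≱
        (tight⇒covered (start≤a k (ℕ.<⇒≤ k<r)) (b≤ (suc k) k<r) (tight (suc k) (s≤s z≤n) k<r) y a≤y y<b))
        where k<r = subst (suc k ≤_) e (s≤s (ℕ.m≤n+m k m))

    lo-b : ∀ k → k ≤ r → lo (b k) ≡ U (b k) × hi (b k) ≡ U (b k)
    lo-b k k≤r = ℕ.≤-antisym (ℕ.≤-trans lo≤hi′ hi≤U) U≤lo′ , ℕ.≤-antisym hi≤U (ℕ.≤-trans U≤lo′ lo≤hi′)
      where
      lo≤hi′ = lo≤hi (start≤b k k≤r) (b≤ k k≤r)
      U≤lo′ = U≤lo (b≤ k k≤r)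
      hi≤U′ : ∀ k → k ≤ r → hi (b k) ≤ U (b k)
      hi≤U′ zero    _   = subst (λ x → hi x ≤ U x) (sym first) (subst (_≤ U 1) (sym hi₁) z≤n)
      hi≤U′ (suc k) k<r = tight-right (start≤a k (ℕ.<⇒≤ k<r)) (b≤ (suc k) k<r)
        (tight (suc k) (s≤s z≤n) k<r) (ℕ.<⇒≤ (a<b (suc k) (s≤s z≤n) k<r))
      hi≤U = hi≤U′ k k≤r

    hi-a : ∀ k → k ≤ r → hi (a (suc k)) ≡ L (a (suc k)) × lo (a (suc k)) ≡ hi (a (suc k))
    hi-a k k≤r = ℕ.≤-antisym (hi≤L _) (ℕ.≤-trans L≤lo lo≤hi′)
               , ℕ.≤-antisym lo≤hi′ (ℕ.≤-trans (hi≤L _) L≤lo)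
      where
      lo≤hi′ = lo≤hi (start≤a k k≤r) (a≤ k k≤r)
      L≤lo : L (a (suc k)) ≤ lo (a (suc k))
      L≤lo with ℕ.m≤n⇒m<n∨m≡n k≤r
      ... | inj₁ k<r  = tight-left (start≤a k k≤r) (b≤ (suc k) k<r) (tight (suc k) (s≤s z≤n) k<r)
                          (ℕ.<⇒≤ (a<b (suc k) (s≤s z≤n) k<r))
      ... | inj₂ k≡r  = subst (λ x → L x ≤ lo x) (sym (trans (cong (λ j → a (suc j)) k≡r) last)) (ℕ.≤-trans (L≤s _) (ℕ.≤-reflexive (sym lo-end)))

    interval : ℕ → ℕ → List ℕ
    interval zero    k = k ∷ []
    interval (suc m) k = k ∷ interval m (suc k)

    applyUpTo-interval : ∀ m k (f : ℕ → ℕ) → (∀ i → f i ≡ i + k) → applyUpTo f (suc m) ≡ interval m k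
    applyUpTo-interval zero    k f e = cong (_∷ []) (e 0)
    applyUpTo-interval (suc m) k f e = cong₂ _∷_ (e 0)
      (applyUpTo-interval m (suc k) (λ i → f (suc i)) (λ i → trans (e (suc i)) (sym (ℕ.+-suc i k))))

    weights-end : ∀ p → weights (suc W) (hi (suc W)) p ↭ (0 , 0) ∷ []
    weights-end p = ↭-reflexive (trans
      (cong (λ d → map weight (words d (suc W) (hi (suc W)) p)) (ℕ.n∸n≡0 W))
      (cong (map weight) (when-yes (hi (suc W) ≟ s)
        (ℕ.≤-antisym (ℕ.≤-trans (hi≤L _) (L≤s _))
          (ℕ.≤-trans (ℕ.≤-reflexive (sym lo-end)) (lo≤hi (s≤s z≤n) ℕ.≤-refl))))))

    -- The condition on `deg k` makes it the number of pure columns: the width of the component less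
    -- the climb of α from `U (b k)` to `L (a (suc k))`, the values at which the two paths meet.
    weights-chain : (∀ k → k ≤ r → ∀ y → b k ≤ y → y < a (suc k) → Uncovered y) →
      (deg : ℕ → ℕ) →
      (∀ k → k ≤ r → a (suc k) ∸ b k + U (b k) ≡ L (a (suc k)) + deg k) →
      weights 1 0 false ↭ ∏P-exponents (map deg (upTo (suc r)))
    weights-chain unc deg deg≡ = ↭-trans
      (↭-reflexive (cong₂ (λ x α → weights x α false) (sym first)
        (sym (trans (proj₁ (lo-b 0 z≤n)) (trans (sym (proj₂ (lo-b 0 z≤n))) (trans (cong hi first) hi₁))))))
      (↭-trans (go r 0 (ℕ.+-identityʳ r))
        (↭-reflexive (cong (λ ks → ∏P-exponents (map deg ks))
          (sym (applyUpTo-interval r 0 (λ i → i) (λ i → sym (ℕ.+-identityʳ i)))))))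
      where
      module _ (k : ℕ) (k≤r : k ≤ r) {R : List Exponent}
               (R↭ : ∀ p → weights (a (suc k)) (hi (a (suc k))) p ↭ R) where
        component-weights : weights (b k) (lo (b k)) false ↭ P-exponents (deg k) ⊛ R
        component-weights = Block.weights-P (a (suc k)) (a≤ k k≤r) (proj₂ (hi-a k k≤r)) R R↭
          (a (suc k) ∸ b k) (ℕ.m∸n+n≡m (b≤a k k≤r))
          (trans (cong (a (suc k) ∸ b k +_) (proj₁ (lo-b k k≤r)))
            (trans (deg≡ k k≤r) (cong (_+ deg k) (sym (proj₁ (hi-a k k≤r))))))
          (start≤b k k≤r) (unc k k≤r)
      go : ∀ m k → m + k ≡ r → weights (b k) (lo (b k)) false ↭ ∏P-exponents (map deg (interval m k))
      go zero k k≡r = component-weights k (ℕ.≤-reflexive k≡r)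
        (λ p → subst (λ x → weights x (hi x) p ↭ (0 , 0) ∷ [])
          (sym (trans (cong (λ j → a (suc j)) k≡r) last)) (weights-end p))
      go (suc m) k m+k≡r = component-weights k (ℕ.<⇒≤ k<r) λ p → ↭-trans
        (↭-reflexive (trans (run p) (cong (λ α → weights (b (suc k)) α false)
          (trans (proj₂ (lo-b (suc k) k<r)) (sym (proj₁ (lo-b (suc k) k<r)))))))
        (go m (suc k) (trans (ℕ.+-suc m k) m+k≡r))
        where
        k<r = subst (suc k ≤_) m+k≡r (s≤s (ℕ.m≤n+m k m))
        run : ∀ p → weights (a (suc k)) (hi (a (suc k))) p ≡ weights (b (suc k)) (hi (b (suc k))) false
        run p with i , i+a ← ≤⇒+ (a<b (suc k) (s≤s z≤n) k<r) =
          trans (weights-covered-run i p (start≤a k (ℕ.<⇒≤ k<r))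
                  (subst (_≤ suc W) (sym e) (b≤ (suc k) k<r))
                  (λ y a≤y y≤ → tight⇒covered (start≤a k (ℕ.<⇒≤ k<r)) (b≤ (suc k) k<r)
                    (tight (suc k) (s≤s z≤n) k<r) y a≤y (subst (suc y ≤_) e (s≤s y≤))))
                (cong (λ x → weights x (hi x) false) e)
          where
          e : suc i + a (suc k) ≡ b (suc k)
          e = trans (sym (ℕ.+-suc i _)) i+a

  -- A chain whose support has only uncovered columns.

  AllUncovered : ∀ {x} → Chain x → Set
  AllUncovered c = ∀ k → k ≤ r → ∀ y → b k ≤ y → y < a (suc k) → Uncovered y
    where open Chain c

  -- A chain may begin with an empty gap, but gaps between two tight intervals must be nonempty.
  -- Prepending an interval turns the first gap into such an inner one, unless no interval follows.
  StartsFree : ∀ {x} → Chain x → Set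
  StartsFree c = 1 ≤ Chain.r c → Chain.b c 0 < Chain.a c 1

  trivial-chain : Chain (suc W)
  trivial-chain = record
    { r = 0 ; a = λ _ → suc W ; b = λ _ → suc W ; first = refl ; last = refl
    ; b₀≤a₁ = ℕ.≤-refl ; a<b = λ { (suc _) _ () } ; b<a = λ _ _ () ; bᵣ≤aᵣ₊₁ = ℕ.≤-refl
    ; tight = λ { (suc _) _ () } }

  module _ {x} (c : Chain (suc x)) where
    open Chain c

    private
      b′ : ℕ → ℕ
      b′ zero    = x
      b′ (suc k) = b (suc k)

      x≤b₀ : x ≤ b 0
      x≤b₀ = subst (x ≤_) (sym first) (ℕ.n≤1+n x)

      b′≤b : ∀ k → b′ k ≤ b k
      b′≤b zero    = x≤b₀
      b′≤b (suc k) = ℕ.≤-refl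

    extend : Chain x
    extend = record
      { r = r ; a = a ; b = b′ ; first = refl ; last = last
      ; b₀≤a₁ = ℕ.≤-trans x≤b₀ b₀≤a₁
      ; a<b = λ { (suc k) → a<b (suc k) }
      ; b<a = λ { (suc k) → b<a (suc k) }
      ; bᵣ≤aᵣ₊₁ = ℕ.≤-trans (b′≤b r) bᵣ≤aᵣ₊₁
      ; tight = λ { (suc k) → tight (suc k) } }

    extend-startsFree : StartsFree extend
    extend-startsFree _ = ℕ.≤-trans (ℕ.≤-reflexive (sym first)) b₀≤a₁

    extend-uncovered : Uncovered x → AllUncovered c → AllUncovered extend
    extend-uncovered unc uncs (suc k) k≤r y b≤y y<a = uncs (suc k) k≤r y b≤y y<a
    extend-uncovered unc uncs zero    k≤r y x≤y y<a with ℕ.m≤n⇒m<n∨m≡n x≤y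
    ... | inj₁ x<y  = uncs 0 k≤r y (subst (_≤ y) (sym first) x<y) y<a
    ... | inj₂ refl = unc

  module _ {x q} (x<q : x < q) (t : Tight x q) (c : Chain q) (free : StartsFree c) where
    open Chain c

    private
      a′ b′ : ℕ → ℕ
      -- A default at the meaningless index 0. The new chain opens with the empty gap [x, x),
      -- followed by the tight interval [x, q).
      a′ zero          = 0
      a′ (suc zero)    = x
      a′ (suc (suc k)) = a (suc k)
      b′ zero    = x
      b′ (suc k) = b k

    close : Chain x
    close = record
      { r = suc r ; a = a′ ; b = b′ ; first = refl ; last = last ; b₀≤a₁ = ℕ.≤-refl
      ; a<b = λ { (suc zero) _ _ → subst (x <_) (sym first) x<q
                ; (suc (suc k)) _ (s≤s k<r) → a<b (suc k) (s≤s z≤n) k<r }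
      ; b<a = λ { (suc zero) _ (s≤s 1≤r) → free 1≤r
                ; (suc (suc k)) _ (s≤s k<r) → b<a (suc k) (s≤s z≤n) k<r }
      ; bᵣ≤aᵣ₊₁ = bᵣ≤aᵣ₊₁
      ; tight = λ { (suc zero) _ _ → subst (Tight x) (sym first) t
                  ; (suc (suc k)) _ (s≤s k<r) → tight (suc k) (s≤s z≤n) k<r } }

    close-uncovered : AllUncovered c → AllUncovered close
    close-uncovered uncs zero    _         y x≤y y<x = contradiction x≤y (ℕ.<⇒≱ y<x)
    close-uncovered uncs (suc k) (s≤s k≤r) y b≤y y<a = uncs k k≤r y b≤y y<a

  CoveredOn : ℕ → ℕ → Set
  CoveredOn x q = ∀ y → x ≤ y → y < q → hi y < lo (suc y)

  covered-hi : ∀ n x → 1 ≤ x → n + x ≤ suc W → CoveredOn x (n + x) → n + hi x ≤ hi (n + x)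
  covered-hi zero    x _   _  _   = ℕ.≤-refl
  covered-hi (suc n) x 1≤x n≤ cov = ℕ.≤-trans
    (s≤s (covered-hi n x 1≤x (ℕ.<⇒≤ n≤) λ y x≤y y< → cov y x≤y (ℕ.m≤n⇒m≤1+n y<)))
    (ℕ.≤-trans (cov (n + x) (ℕ.m≤n+m x n) ℕ.≤-refl) (lo≤hi (s≤s z≤n) n≤))

  -- Over covered columns `hi` gains one per column, starting from `L x`, and the last covered
  -- column puts `lo q` one above the value of `hi` before q. As `lo q` is `U q`, this is one
  -- inequality; Hall's condition is the other.
  covered⇒tight : ∀ {x q} → 1 ≤ x → x < q → q ≤ suc W → CoveredOn x q →
    hi x ≡ L x → U q ≡ lo q → Tight x q
  covered⇒tight {x} 1≤x x<q q≤ cov hi≡L U≡lo with ≤⇒+ x<q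
  ... | n , refl = ℕ.≤-antisym (hall _ _ 1≤x (ℕ.<⇒≤ x<q) q≤) (begin
    L x + (n + suc x ∸ x)   ≡⟨ cong₂ (λ h e → h + (e ∸ x)) (sym hi≡L) (ℕ.+-suc n x) ⟩
    hi x + (suc n + x ∸ x)  ≡⟨ cong (hi x +_) (ℕ.m+n∸n≡m (suc n) x) ⟩
    hi x + suc n            ≡⟨ ℕ.+-comm (hi x) _ ⟩
    suc (n + hi x)          ≤⟨ s≤s (covered-hi n x 1≤x (ℕ.<⇒≤ q≤′) (λ y x≤y y< → cov y x≤y (≤q y<))) ⟩
    suc (hi (n + x))        ≤⟨ cov (n + x) (ℕ.m≤n+m x n) (subst (n + x <_) (sym (ℕ.+-suc n x)) ℕ.≤-refl) ⟩
    lo (suc n + x)          ≡⟨ cong lo (sym (ℕ.+-suc n x)) ⟩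
    lo (n + suc x)          ≡⟨ sym U≡lo ⟩
    U (n + suc x)           ∎)
    where
    open ℕ.≤-Reasoning
    q≤′ : suc (n + x) ≤ suc W
    q≤′ = subst (_≤ suc W) (ℕ.+-suc n x) q≤
    ≤q : ∀ {y} → y < n + x → y < n + suc x
    ≤q {y} y< = subst (y <_) (sym (ℕ.+-suc n x)) (ℕ.m≤n⇒m≤1+n y<)

  -- If `hi` rose by one from x, then lo (x+2) ≤ lo (x+1) + 1 ≤ hi x + 1 = hi (x+1), although x + 1
  -- is covered.
  run-start : ∀ {x} → suc x ≤ W → Uncovered x → hi (suc x) < lo (suc (suc x)) → hi (suc x) ≡ L (suc x)
  run-start {x} x<W unc cov with ℕ.⊓-sel (L (suc x)) (suc (hi x))
  ... | inj₁ e = e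
  ... | inj₂ e = contradiction
    (ℕ.≤-trans (ℕ.≤-pred (ℕ.≤-trans cov (lo-suc x<W))) unc)
    (ℕ.<⇒≱ (ℕ.≤-reflexive (sym e)))

  -- If `lo` rose by one from x + 1, then lo (x+2) ≤ hi (x+1) ≤ hi x + 1 ≤ lo (x+1) would be absurd.
  -- Since x is covered, lo (x+1) is positive, so the predecessor in the recursion of `lo` is a
  -- genuine one.
  run-end : ∀ {x} → 1 ≤ x → suc x ≤ W → hi x < lo (suc x) → Uncovered (suc x) → U (suc x) ≡ lo (suc x)
  run-end {x} 1≤x x<W cov unc with ℕ.⊔-sel (U (suc x)) (lo (suc (suc x)) ∸ 1)
  ... | inj₁ e = sym (trans (lo-step x<W) e)
  ... | inj₂ e = contradiction
    (subst (lo (suc (suc x)) ≤_) lo≡ (ℕ.≤-trans unc (ℕ.≤-trans (hi-suc x) cov)))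
    (no-drop _ (subst (1 ≤_) lo≡ (ℕ.≤-trans (s≤s z≤n) cov)))
    where
    lo≡ : lo (suc x) ≡ lo (suc (suc x)) ∸ 1
    lo≡ = trans (lo-step x<W) e
    no-drop : ∀ m → 1 ≤ m ∸ 1 → ¬ m ≤ m ∸ 1
    no-drop (suc m) _ = ℕ.1+n≰n

  -- The state of the sweep from right to left: `free` when no covered run is open at x, `run` when
  -- [x, q) is covered and its left end is still to be found. Only at that left end is the interval
  -- known to be tight.
  data Suffix (x : ℕ) : Set where
    free : (c : Chain x) → AllUncovered c → StartsFree c → x ≡ suc W ⊎ Uncovered x → Suffix x
    run  : ∀ q → x < q → q ≤ suc W → CoveredOn x q → U q ≡ lo q →
           (c : Chain q) → AllUncovered c → StartsFree c → Suffix x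

  suffix-step : ∀ {x} → 1 ≤ x → x ≤ W → Suffix (suc x) → Suffix x
  suffix-step {x} 1≤x x≤W S with ℕ.≤-<-connex (lo (suc x)) (hi x)
  suffix-step 1≤x x≤W (free c uncs _ _) | inj₁ unc =
    free (extend c) (extend-uncovered c unc uncs) (extend-startsFree c) (inj₂ unc)
  suffix-step 1≤x x≤W (run q x<q q≤ cov U≡lo c uncs fr) | inj₁ unc =
    free (extend c′) (extend-uncovered c′ unc (close-uncovered x<q t c fr uncs)) (extend-startsFree c′) (inj₂ unc)
    where
    t  = covered⇒tight (s≤s z≤n) x<q q≤ cov
           (run-start (ℕ.≤-pred (ℕ.≤-trans x<q q≤)) unc (cov _ ℕ.≤-refl x<q)) U≡lo
    c′ = close x<q t c fr
  suffix-step {x} 1≤x x≤W (free c uncs fr ready) | inj₂ cov =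
    run (suc x) ℕ.≤-refl (s≤s x≤W)
      (λ y x≤y y<1+x → subst (λ z → hi z < lo (suc z)) (ℕ.≤-antisym x≤y (ℕ.≤-pred y<1+x)) cov)
      (run-ends ready) c uncs fr
    where
    run-ends : suc x ≡ suc W ⊎ Uncovered (suc x) → U (suc x) ≡ lo (suc x)
    run-ends (inj₁ refl) = trans Uₑ (sym lo-end)
    run-ends (inj₂ unc) with ℕ.m≤n⇒m<n∨m≡n x≤W
    ... | inj₁ x<W  = run-end 1≤x x<W cov unc
    ... | inj₂ refl = trans Uₑ (sym lo-end)
  suffix-step {x} 1≤x x≤W (run q x<q q≤ covs U≡lo c uncs fr) | inj₂ cov =
    run q (ℕ.<⇒≤ x<q) q≤ covs′ U≡lo c uncs fr
    where
    covs′ : CoveredOn x q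
    covs′ y x≤y y<q with ℕ.m≤n⇒m<n∨m≡n x≤y
    ... | inj₁ x<y  = covs y x<y y<q
    ... | inj₂ refl = cov

  suffix : ∀ n x → n + x ≡ suc W → 1 ≤ x → Suffix x
  suffix zero    x refl _   = free trivial-chain (λ _ _ _ b≤y y<a → contradiction b≤y (ℕ.<⇒≱ y<a)) (λ ()) (inj₁ refl)
  suffix (suc n) x e    1≤x = suffix-step 1≤x (subst (x ≤_) (ℕ.suc-injective e) (ℕ.m≤n+m x n))
    (suffix n (suc x) (trans (ℕ.+-suc n x) e) (s≤s z≤n))

  canonical : ∃ λ (c : Chain 1) → AllUncovered c
  canonical with suffix W 1 (ℕ.+-comm W 1) ℕ.≤-refl
  ... | free c uncs _ _ = c , uncs
  -- A run that reaches the first column is closed there, since hi 1 = 0 = L 1.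
  ... | run q 1<q q≤ cov U≡lo c uncs fr = close 1<q t c fr , close-uncovered 1<q t c fr uncs
    where t = covered⇒tight ℕ.≤-refl 1<q q≤ cov (trans hi₁ (sym L₁)) U≡lo

-- Supports of the entries of ν

module _ {A : Set} where

  AllPairs-All : ∀ {P : Pred A 0ℓ} {R : A → A → Set} {xs} → All P xs → AllPairs R xs →
    AllPairs (λ x y → P x × P y × R x y) xs
  AllPairs-All []         []         = []
  AllPairs-All (px ∷ pxs) (rx ∷ rxs) =
    All.map (λ (py , rxy) → px , py , rxy) (All.zip (pxs , rx)) ∷ AllPairs-All pxs rxs

  module _ {P : Pred A 0ℓ} (P? : Decidable P) where

    count : List A → ℕ
    count xs = length (filter P? xs)

    count-++ : ∀ xs ys → count (xs ++ ys) ≡ count xs + count ys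
    count-++ xs ys = trans (cong length (List.filter-++ P? xs ys)) (List.length-++ (filter P? xs))

    count-all : ∀ {xs} → All P xs → count xs ≡ length xs
    count-all pxs = cong length (List.filter-all P? pxs)

    count-none : ∀ {xs} → All (λ x → ¬ P x) xs → count xs ≡ 0
    count-none pxs = cong length (List.filter-none P? pxs)

    count-∷-yes : ∀ {x xs} → P x → count (x ∷ xs) ≡ suc (count xs)
    count-∷-yes px = cong length (List.filter-accept P? px)

    count-∷-no : ∀ {x xs} → ¬ P x → count (x ∷ xs) ≡ count xs
    count-∷-no px = cong length (List.filter-reject P? px)

    count≥ : ∀ {xs} ys → All P xs → length xs ≤ count (xs ++ ys)
    count≥ {xs} ys pxs = ℕ.≤-trans (ℕ.≤-reflexive (sym (count-all pxs)))
      (ℕ.≤-trans (ℕ.m≤m+n _ _) (ℕ.≤-reflexive (sym (count-++ xs ys))))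

    count≤ : ∀ xs {ys} → All (λ x → ¬ P x) ys → count (xs ++ ys) ≤ length xs
    count≤ xs {ys} pys = begin
      count (xs ++ ys)     ≡⟨ count-++ xs ys ⟩
      count xs + count ys  ≡⟨ cong (count xs +_) (count-none pys) ⟩
      count xs + 0         ≡⟨ ℕ.+-identityʳ _ ⟩
      count xs             ≤⟨ List.length-filter P? xs ⟩
      length xs            ∎
      where open ℕ.≤-Reasoning

    -- The elements satisfying `P` form a prefix of the list.
    InitiallyClosed : List A → Set
    InitiallyClosed = AllPairs (λ x y → P y → P x)

    count-closed-no : ∀ xs {y ys} → InitiallyClosed (xs ++ y ∷ ys) → ¬ P y → count (xs ++ y ∷ ys) ≤ length xs
    count-closed-no xs cl ¬py = count≤ xs (¬py ∷ All.map (λ f pz → ¬py (f pz)) (tail xs cl))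
      where
      tail : ∀ xs {y ys} → InitiallyClosed (xs ++ y ∷ ys) → All (λ z → P z → P y) ys
      tail []       (a ∷ _)  = a
      tail (x ∷ xs) (_ ∷ cl) = tail xs cl

    count-closed-yes : ∀ xs {y ys} → InitiallyClosed (xs ++ y ∷ ys) → P y → length xs < count (xs ++ y ∷ ys)
    count-closed-yes []       {ys = ys} cl py = ℕ.≤-trans (s≤s z≤n) (ℕ.≤-reflexive (sym (count-∷-yes {xs = ys} py)))
    count-closed-yes (x ∷ xs) (a ∷ cl) py = ℕ.≤-trans (s≤s (count-closed-yes xs cl py))
      (ℕ.≤-reflexive (sym (count-∷-yes (All.head (All.++⁻ʳ xs a) py))))

  count-mono : ∀ {P Q : Pred A 0ℓ} (P? : Decidable P) (Q? : Decidable Q) {xs} →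
    All (λ x → P x → Q x) xs → count P? xs ≤ count Q? xs
  count-mono P? Q? []         = z≤n
  count-mono P? Q? {x ∷ xs} (f ∷ fs) with P? x
  ... | no ¬px = ℕ.≤-trans (count-mono P? Q? fs) (≤count-∷ Q? x xs)
    where
    ≤count-∷ : ∀ {Q : Pred A 0ℓ} (Q? : Decidable Q) x xs → count Q? xs ≤ count Q? (x ∷ xs)
    ≤count-∷ Q? x xs with Q? x
    ... | yes _ = ℕ.n≤1+n _
    ... | no _  = ℕ.≤-refl
  ... | yes px = ℕ.≤-trans (s≤s (count-mono P? Q? fs)) (ℕ.≤-reflexive (sym (count-∷-yes Q? (f px))))

  -- Two prefixes of one list are nested, and R is the difference Q minus P. If P is the longer
  -- prefix, R is empty and the truncated subtraction gives 0 as well.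
  count-∸ : ∀ {P Q R : Pred A 0ℓ} (P? : Decidable P) (Q? : Decidable Q) (R? : Decidable R) {xs} →
    InitiallyClosed P? xs → InitiallyClosed Q? xs →
    All (λ x → (R x → Q x × ¬ P x) × (Q x → ¬ P x → R x)) xs →
    count R? xs ≡ count Q? xs ∸ count P? xs
  count-∸ P? Q? R? [] [] [] = refl
  count-∸ P? Q? R? {x ∷ xs} (p ∷ ps) (q ∷ qs) ((r→ , →r) ∷ rs) with P? x | Q? x
  ... | yes px | yes qx = trans (count-∷-no R? (λ r → proj₂ (r→ r) px)) (count-∸ P? Q? R? ps qs rs)
  ... | yes px | no ¬qx = trans (count-∷-no R? (λ r → ¬qx (proj₁ (r→ r))))
    (trans (count-∸ P? Q? R? ps qs rs)
      (trans (cong (_∸ count P? xs) none) (trans (ℕ.0∸n≡0 (count P? xs)) (sym (cong (_∸ suc (count P? xs)) none)))))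
    where none = count-none Q? (All.map (λ f qy → ¬qx (f qy)) q)
  ... | no ¬px | yes qx = trans (count-∷-yes R? (→r qx ¬px))
    (trans (cong suc (trans (count-∸ P? Q? R? ps qs rs) (cong (count Q? xs ∸_) none)))
           (cong (suc (count Q? xs) ∸_) (sym none)))
    where none = count-none P? (All.map (λ f py → ¬px (f py)) p)
  ... | no ¬px | no ¬qx = trans (count-∷-no R? (λ r → ¬qx (proj₁ (r→ r)))) (count-∸ P? Q? R? ps qs rs)

nth-antitone : ∀ {xs} → Linked _≥_ xs → ∀ {i j} → 1 ≤ i → i ≤ j → nth xs j ≤ nth xs i
nth-antitone {[]}         _        _ _ = z≤n
nth-antitone {x ∷ xs}     l {suc zero} {j} _ _ = nth-≤-first l j
nth-antitone {x ∷ []}     _ _ (s≤s (s≤s _)) = z≤n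
nth-antitone {x ∷ y ∷ xs} (_ ∷ l) _ (s≤s i≤j@(s≤s _)) = nth-antitone l (s≤s z≤n) i≤j

part-antitone : ∀ ν {i j} → 1 ≤ i → i ≤ j → part ν j ≤ part ν i
part-antitone ν = nth-antitone (decreasing ν)

module Geometry (S : SkewPartition) where

  outerPart innerPart : ℕ → ℕ
  outerPart = part (outer S)
  innerPart = part (inner S)

  Shape⁺ : ∀ {i j} → 1 ≤ i → innerPart i < j → j ≤ outerPart i → (i , j) ∈ Shape S
  Shape⁺ 1≤i μ<j j≤λ = (1≤i , ℕ.≤-trans (s≤s z≤n) μ<j , j≤λ) , λ (_ , _ , j≤μ) → ℕ.<⇒≱ μ<j j≤μ

  Shape⁻ : ∀ {i j} → (i , j) ∈ Shape S → 1 ≤ i × 1 ≤ j × innerPart i < j × j ≤ outerPart i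
  Shape⁻ ((1≤i , 1≤j , j≤λ) , ∉μ) = 1≤i , 1≤j , ℕ.≰⇒> (λ j≤μ → ∉μ (1≤i , 1≤j , j≤μ)) , j≤λ

  supp⁺ : ∀ {i j} → 1 ≤ i → innerPart i < j → j ≤ outerPart (suc i) → j ∈ supp S i
  supp⁺ 1≤i μ<j j≤λ =
      Shape⁺ 1≤i μ<j (ℕ.≤-trans j≤λ (part-antitone (outer S) 1≤i (ℕ.n≤1+n _)))
    , Shape⁺ (s≤s z≤n) (ℕ.≤-<-trans (part-antitone (inner S) 1≤i (ℕ.n≤1+n _)) μ<j) j≤λ

  supp⁻ : ∀ {i j} → j ∈ supp S i → 1 ≤ i × innerPart i < j × j ≤ outerPart (suc i)
  supp⁻ (c , d) = proj₁ (Shape⁻ c) , proj₁ (proj₂ (proj₂ (Shape⁻ c))) , proj₂ (proj₂ (proj₂ (Shape⁻ d)))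

  -- supp i = [innerPart i + 1 , outerPart (suc i)]
  Opened Closed : ℕ → Pred ℕ 0ℓ
  Opened x i = suc (innerPart i) < x
  Closed x i = outerPart (suc i) < x

  Opened? : ∀ x → Decidable (Opened x)
  Opened? x i = suc (innerPart i) <? x

  Closed? : ∀ x → Decidable (Closed x)
  Closed? x i = outerPart (suc i) <? x

  module Counts (ν : Partition) (representable : Representable S ν) where

    W s : ℕ
    W = width S
    s = # ν

    L U : ℕ → ℕ
    L x = count (Opened? x) (parts ν)
    U x = count (Closed? x) (parts ν)

    nonempty : All (λ i → 1 ≤ i × innerPart i < outerPart (suc i)) (parts ν)
    nonempty = All.map (λ (j , j∈) → let 1≤i , μ<j , j≤λ = supp⁻ j∈ in 1≤i , ℕ.<-≤-trans μ<j j≤λ)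
      (proj₁ representable)

    sorted : AllPairs (λ i i′ → (1 ≤ i × innerPart i < outerPart (suc i)) ×
                                (1 ≤ i′ × innerPart i′ < outerPart (suc i′)) × i ≥ i′) (parts ν)
    sorted = AllPairs-All nonempty
      (Linked.Linked⇒AllPairs (λ p q → ℕ.≤-trans q p) (decreasing ν))

    opened-closed : ∀ x → InitiallyClosed (Opened? x) (parts ν)
    opened-closed x = AllPairs.map
      (λ (_ , (1≤i′ , _) , i≥i′) → ℕ.≤-<-trans (s≤s (part-antitone (inner S) 1≤i′ i≥i′))) sorted

    closed-closed : ∀ x → InitiallyClosed (Closed? x) (parts ν)
    closed-closed x = AllPairs.map
      (λ (_ , _ , i≥i′) → ℕ.≤-<-trans (part-antitone (outer S) (s≤s z≤n) (s≤s i≥i′))) sorted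

    L-mono : ∀ x → L x ≤ L (suc x)
    L-mono x = count-mono (Opened? x) (Opened? (suc x)) (All.universal (λ _ → ℕ.m≤n⇒m≤1+n) (parts ν))

    U-mono : ∀ x → U x ≤ U (suc x)
    U-mono x = count-mono (Closed? x) (Closed? (suc x)) (All.universal (λ _ → ℕ.m≤n⇒m≤1+n) (parts ν))

    L₁ : L 1 ≡ 0
    L₁ = count-none (Opened? 1) (All.universal (λ { _ (s≤s ()) }) (parts ν))

    Uₑ : U (suc W) ≡ s
    Uₑ = count-all (Closed? (suc W))
      (All.universal (λ i → s≤s (nth-≤-first (decreasing (outer S)) (suc i))) (parts ν))

    L≤s : ∀ x → L x ≤ s
    L≤s x = List.length-filter (Opened? x) (parts ν)

    U≤L : ∀ x → U x ≤ L x
    U≤L x = count-mono (Closed? x) (Opened? x) (All.map (λ (_ , μ<λ) → ℕ.≤-<-trans μ<λ) nonempty)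

    #restrict⊆ : ∀ a b → # restrict⊆ S ν a b ≡ U b ∸ L a
    #restrict⊆ a b = count-∸ (Opened? a) (Closed? b) (supp⊆? S a b) (opened-closed a) (closed-closed b)
      (All.map (λ (1≤i , μ<λ) →
          (λ ⊆ab → proj₂ (⊆ab (supp⁺ 1≤i μ<λ ℕ.≤-refl)) ,
                   ℕ.≤⇒≯ (proj₁ (⊆ab (supp⁺ 1≤i ℕ.≤-refl μ<λ))))
        , (λ λ<b μ≮a {j} j∈ → let _ , μ<j , j≤λ = supp⁻ j∈ in
             ℕ.≤-trans (ℕ.≮⇒≥ μ≮a) μ<j , ℕ.≤-<-trans j≤λ λ<b))
        nonempty)

    #restrict∩ : ∀ {a b} → a < b → # restrict∩ S ν a b ≡ L b ∸ U a
    #restrict∩ {a} {b} a<b = count-∸ (Closed? a) (Opened? b) (supp≬? S a b) (closed-closed a) (opened-closed b)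
      (All.map (λ {i} (1≤i , μ<λ) →
          (λ (j , j∈ , a≤j , j<b) → let _ , μ<j , j≤λ = supp⁻ j∈ in
             ℕ.≤-<-trans μ<j j<b , ℕ.≤⇒≯ (ℕ.≤-trans a≤j j≤λ))
        -- The larger of the two left ends is a common column of two overlapping intervals.
        , (λ μ<b λ≮a → suc (innerPart i) ⊔ a ,
             supp⁺ 1≤i (ℕ.m≤m⊔n _ a) (ℕ.⊔-lub μ<λ (ℕ.≮⇒≥ λ≮a)) ,
             ℕ.m≤n⊔m (suc (innerPart i)) a , ℕ.⊔-lub μ<b a<b))
        nonempty)

    hall : ∀ a b → 1 ≤ a → a ≤ b → b ≤ suc W → U b ≤ L a + (b ∸ a)
    hall a b _ a≤b _ with ℕ.m≤n⇒m<n∨m≡n a≤b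
    ... | inj₂ refl = ℕ.≤-trans (U≤L a) (ℕ.m≤m+n _ _)
    ... | inj₁ a<b  = ℕ.≤-trans (ℕ.m≤n+m∸n (U b) (L a))
      (ℕ.+-monoʳ-≤ (L a) (subst (_≤ b ∸ a) (#restrict⊆ a b) (proj₂ representable a b a<b)))

    open Paths W s L U L-mono U-mono L₁ Uₑ L≤s hall public

∸⇒+ : ∀ {m n o} → 1 ≤ o → m ∸ n ≡ o → m ≡ n + o
∸⇒+ {m} {n} 1≤o refl = sym (ℕ.m+[n∸m]≡n (ℕ.<⇒≤ (ℕ.m∸n≢0⇒n<m {m} {n} (ℕ.>⇒≢ 1≤o))))

+≡+∸ : ∀ {n u l} → u ≤ l → l ≤ n + u → n + u ≡ l + (n ∸ (l ∸ u))
+≡+∸ {n} {u} {l} u≤l l≤n+u = begin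
  n + u                         ≡⟨ cong (_+ u) (sym (ℕ.m∸n+n≡m t≤n)) ⟩
  n ∸ (l ∸ u) + (l ∸ u) + u     ≡⟨ ℕ.+-assoc (n ∸ (l ∸ u)) _ u ⟩
  n ∸ (l ∸ u) + (l ∸ u + u)     ≡⟨ cong (n ∸ (l ∸ u) +_) (ℕ.m∸n+n≡m u≤l) ⟩
  n ∸ (l ∸ u) + l               ≡⟨ ℕ.+-comm (n ∸ (l ∸ u)) l ⟩
  l + (n ∸ (l ∸ u))             ∎
  where
  open ≡-Reasoning
  t≤n : l ∸ u ≤ n
  t≤n = ℕ.m≤n+o⇒m∸n≤o l u (subst (l ≤_) (ℕ.+-comm n u) l≤n+u)

module _ (S : SkewPartition) (ν : Partition) (representable : Representable S ν) where
  open Geometry S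
  open Counts ν representable

  fromTight : TightSequence S ν → Chain 1
  fromTight t = record
    { r = r ; a = a ; b = b ; first = first ; last = last ; b₀≤a₁ = b₀≤a₁ ; a<b = a<b ; b<a = b<a
    ; bᵣ≤aᵣ₊₁ = bᵣ≤aᵣ₊₁
    ; tight = λ k 1≤k k≤r → ∸⇒+ (ℕ.m<n⇒0<n∸m (a<b k 1≤k k≤r))
        (trans (sym (#restrict⊆ (a k) (b k))) (tight k 1≤k k≤r)) }
    where open TightSequence t

  toTight : Chain 1 → TightSequence S ν
  toTight c = record
    { r = r ; a = a ; b = b ; first = first ; last = last ; b₀≤a₁ = b₀≤a₁ ; a<b = a<b ; b<a = b<a
    ; bᵣ≤aᵣ₊₁ = bᵣ≤aᵣ₊₁
    ; tight = λ k 1≤k k≤r → trans (#restrict⊆ (a k) (b k))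
        (trans (cong (_∸ L (a k)) (tight k 1≤k k≤r)) (ℕ.m+n∸m≡n (L (a k)) _)) }
    where open Chain c

  module _ (D : IrreducibleDecomposition S ν) where
    open IrreducibleDecomposition D
    private c = fromTight sequence

    -- The support of the canonical chain consists of uncovered columns, hence lies in the given
    -- support. By minimality the reverse inclusion holds too.
    irreducible-uncovered : AllUncovered c
    irreducible-uncovered k k≤r y b≤y y<a
      with minimal (toTight (proj₁ canonical)) canonical⊆ (k , k≤r , b≤y , y<a)
      where
      canonical⊆ : ∀ {x} → TightSequence.support (toTight (proj₁ canonical)) x → support x
      canonical⊆ {x} (k , k≤r , b≤x , x<a) = uncovered⇒support c
        (ℕ.≤-trans (Chain.start≤b (proj₁ canonical) k k≤r) b≤x)
        (ℕ.≤-pred (ℕ.<-≤-trans x<a (Chain.a≤ (proj₁ canonical) k k≤r)))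
        (proj₂ canonical k k≤r x b≤x x<a)
    ... | k′ , k′≤r , b≤y′ , y<a′ = proj₂ canonical k′ k′≤r y b≤y′ y<a′

    gaps : ∀ k → k ≤ r → a (suc k) ∸ b k + U (b k) ≡ L (a (suc k)) + degree k
    gaps k k≤r with ℕ.m≤n⇒m<n∨m≡n (Chain.b≤a c k k≤r)
    -- An empty gap has degree 0, and U = hi = L at its column.
    ... | inj₂ b≡a rewrite sym b≡a | ℕ.n∸n≡0 (b k) | ℕ.0∸n≡0 (# restrict∩ S ν (b k) (b k)) =
      trans (sym (proj₂ (lo-b c k k≤r))) (trans
        (subst (λ x → hi x ≡ L x) (sym b≡a) (proj₁ (hi-a c k k≤r))) (sym (ℕ.+-identityʳ _)))
    ... | inj₁ b<a rewrite #restrict∩ b<a = +≡+∸ U≤L′ L≤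
      where
      n = a (suc k) ∸ b k
      n+b : n + b k ≡ a (suc k)
      n+b = ℕ.m∸n+n≡m (ℕ.<⇒≤ b<a)
      hi-+-mono : ∀ m x → hi x ≤ hi (m + x)
      hi-+-mono zero    x = ℕ.≤-refl
      hi-+-mono (suc m) x = ℕ.≤-trans (hi-+-mono m x) (hi-mono (m + x))
      U≤L′ : U (b k) ≤ L (a (suc k))
      U≤L′ = subst (_≤ L (a (suc k))) (proj₂ (lo-b c k k≤r))
        (ℕ.≤-trans (subst (λ x → hi (b k) ≤ hi x) n+b (hi-+-mono n (b k))) (hi≤L _))
      L≤ : L (a (suc k)) ≤ n + U (b k)
      L≤ = subst (_≤ n + U (b k)) (proj₁ (hi-a c k k≤r))
        (subst (λ h → hi (a (suc k)) ≤ n + h) (proj₂ (lo-b c k k≤r))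
          (subst (λ x → hi x ≤ n + hi (b k)) n+b (hi-+ n (b k))))

    weights-irreducible : weights 1 0 false ↭ ∏P-exponents degrees
    weights-irreducible = weights-chain c irreducible-uncovered degree gaps

-- Columns of a filling

lookup-injective : {A : Set} {xs : List A} → Unique xs → ∀ {i j} → lookup xs i ≡ lookup xs j → i ≡ j
lookup-injective (x∉ ∷ u) {Fin.zero}  {Fin.zero}  _ = refl
lookup-injective (x∉ ∷ u) {Fin.zero}  {Fin.suc j} e = contradiction e (All.lookup x∉ (∈-lookup j))
lookup-injective (x∉ ∷ u) {Fin.suc i} {Fin.zero}  e = contradiction (sym e) (All.lookup x∉ (∈-lookup i))
lookup-injective (x∉ ∷ u) {Fin.suc i} {Fin.suc j} e = cong Fin.suc (lookup-injective u e)

module _ {A : Set} {P : Pred A 0ℓ} (P? : Decidable P) where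

  filter-map : {B : Set} {Q : Pred B 0ℓ} (Q? : Decidable Q) (f : B → A) →
    (∀ x → (Q x → P (f x)) × (P (f x) → Q x)) → ∀ xs → filter P? (map f xs) ≡ map f (filter Q? xs)
  filter-map Q? f Q⇔P []       = refl
  filter-map Q? f Q⇔P (x ∷ xs) with Q? x
  ... | yes q = trans (List.filter-accept P? (proj₁ (Q⇔P x) q)) (cong (f x ∷_) (filter-map Q? f Q⇔P xs))
  ... | no ¬q = trans (List.filter-reject P? (¬q ∘ proj₂ (Q⇔P x))) (filter-map Q? f Q⇔P xs)

  filter-⊆ : {Q : Pred A 0ℓ} (Q? : Decidable Q) → P ⊆ Q → ∀ xs → filter P? (filter Q? xs) ≡ filter P? xs
  filter-⊆ Q? P⊆Q []       = refl
  filter-⊆ Q? P⊆Q (x ∷ xs) with Q? x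
  ... | no ¬q = trans (filter-⊆ Q? P⊆Q xs) (sym (List.filter-reject P? (¬q ∘ P⊆Q)))
  ... | yes q with P? x
  ...   | yes p = cong (x ∷_) (filter-⊆ Q? P⊆Q xs)
  ...   | no ¬p = filter-⊆ Q? P⊆Q xs

  filter-singleton : ∀ {x xs} → Unique xs → x ∈ˡ xs → P x → (∀ {y} → P y → y ≡ x) → filter P? xs ≡ x ∷ []
  filter-singleton (x∉ ∷ u) (here refl) px only = trans (List.filter-accept P? px)
    (cong (_ ∷_) (List.filter-none P? (All.map (λ x≢y py → x≢y (sym (only py))) x∉)))
  filter-singleton (y∉ ∷ u) (there x∈) px only =
    trans (List.filter-reject P? (λ py → All.lookup y∉ x∈ (only py))) (filter-singleton u x∈ px only)

columns : ℕ → ℕ → List ℕ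
columns x zero    = []
columns x (suc d) = x ∷ columns (suc x) d

⟦⟧≡columns : ∀ n → ⟦ n ⟧ ≡ columns 1 n
⟦⟧≡columns n = trans (List.map-upTo suc n) (go n 1 suc (λ _ → ℕ.+-comm 1 _))
  where
  go : ∀ n x (f : ℕ → ℕ) → (∀ i → f i ≡ i + x) → applyUpTo f n ≡ columns x n
  go zero    x f e = refl
  go (suc n) x f e = cong₂ _∷_ (e 0) (go n (suc x) (f ∘ suc) (λ i → trans (e (suc i)) (sym (ℕ.+-suc i x))))

module _ (S : SkewPartition) where
  open Geometry S

  #rows : ℕ
  #rows = # outer S

  grid : List (ℕ × ℕ)
  grid = cartesianProductWith (λ j i → i , j) ⟦ width S ⟧ ⟦ #rows ⟧

  coords∈Shape : ∀ c → coords S c ∈ Shape S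
  coords∈Shape c = All.lookup (All.all-filter (Shape? S) grid) (∈-lookup {xs = cells S} c)

  coords-injective : ∀ {c d} → coords S c ≡ coords S d → c ≡ d
  coords-injective = lookup-injective (cells-unique S)

  cellAt : ∀ {i j} → (i , j) ∈ Shape S → ∃ λ c → coords S c ≡ (i , j)
  cellAt c∈ = index (cells-complete S c∈) , sym (Any.lookup-index (cells-complete S c∈))

  row≤#rows : ∀ {i j} → (i , j) ∈ Shape S → i ≤ #rows
  row≤#rows {i} c∈ with 1≤i , 1≤j , _ , j≤λ ← Shape⁻ c∈ =
    nonzero⇒≤length (parts (outer S)) i (ℕ.≤-trans 1≤j j≤λ)

  module _ (T : Filling S) where

    At : Entry → ℕ → ℕ → Set
    At e i j = ∃ λ c → coords S c ≡ (i , j) × T c ≡ e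

    At⇒Shape : ∀ {e i j} → At e i j → (i , j) ∈ Shape S
    At⇒Shape (c , refl , _) = coords∈Shape c

    At-split : ∀ {i j} → (i , j) ∈ Shape S → At 𝟙 i j ⊎ At 𝟚 i j
    At-split c∈ with cellAt c∈
    ... | c , e with T c in t
    ...   | 𝟙 = inj₁ (c , e , t)
    ...   | 𝟚 = inj₂ (c , e , t)

    At⇒InColumn : ∀ {e i j} → At e i j → InColumn S T e j
    At⇒InColumn (c , refl , t) = c , refl , t

    InColumn⇒At : ∀ {e j} → InColumn S T e j → ∃ λ i → At e i j
    InColumn⇒At (c , refl , t) = row S c , c , refl , t

    -- Indexed by position instead of by index into `cells S`, so that separators can be listed one
    -- column at a time.
    SepAt : Pred (ℕ × ℕ) 0ℓ
    SepAt p = ∃ λ c → coords S c ≡ p × Separates S T c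

    SepAt? : Decidable SepAt
    SepAt? p = Fin.any? λ c → ≡-dec _≟_ _≟_ (coords S c) p ×-dec Separates? S T c

    SepAt⁺ : ∀ {i j} → At 𝟙 i j → At 𝟚 (suc i) j → SepAt (i , j)
    SepAt⁺ (c , refl , t) (d , e , t′) = c , refl , t , d , e , t′

    SepAt⁻ : ∀ {i j} → SepAt (i , j) → At 𝟙 i j × At 𝟚 (suc i) j
    SepAt⁻ (c , refl , t , d , e , t′) = (c , refl , t) , (d , e , t′)

    columnSeps : ℕ → List ℕ
    columnSeps j = filter (λ i → SepAt? (i , j)) ⟦ #rows ⟧

    -- The cells are enumerated column by column and every separator is a cell, so filtering the
    -- cells may be replaced by filtering each column of the full grid.
    seplist≡ : seplist S T ≡ concatMap columnSeps (columns 1 (width S))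
    seplist≡ = begin
      map (row S) (filter (Separates? S T) (allFin _))
        ≡⟨ List.map-∘ (filter (Separates? S T) (allFin _)) ⟩
      map proj₁ (map (coords S) (filter (Separates? S T) (allFin _)))
        ≡⟨ cong (map proj₁) (sym (filter-map SepAt? (Separates? S T) (coords S)
             (λ c → (λ sep → c , refl , sep)
                  , (λ (d , e , sep) → subst (Separates S T) (coords-injective e) sep)) (allFin _))) ⟩
      map proj₁ (filter SepAt? (map (coords S) (allFin _)))
        ≡⟨ cong (map proj₁ ∘ filter SepAt?) (trans (List.map-tabulate id (coords S)) (List.tabulate-lookup (cells S))) ⟩
      map proj₁ (filter SepAt? (cells S))
        ≡⟨ cong (map proj₁) (filter-⊆ SepAt? (Shape? S) (λ { (c , refl , _) → coords∈Shape c }) grid) ⟩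
      map proj₁ (filter SepAt? grid)
        ≡⟨ by-columns ⟦ width S ⟧ ⟩
      concatMap columnSeps ⟦ width S ⟧
        ≡⟨ cong (concatMap columnSeps) (⟦⟧≡columns (width S)) ⟩
      concatMap columnSeps (columns 1 (width S)) ∎
      where
      open ≡-Reasoning
      by-columns : ∀ js → map proj₁ (filter SepAt? (cartesianProductWith (λ j i → i , j) js ⟦ #rows ⟧))
                        ≡ concatMap columnSeps js
      by-columns []       = refl
      by-columns (j ∷ js) = begin
        map proj₁ (filter SepAt? (map (_, j) ⟦ #rows ⟧ ++ cartesianProductWith (λ j i → i , j) js ⟦ #rows ⟧))
          ≡⟨ cong (map proj₁) (List.filter-++ SepAt? (map (_, j) ⟦ #rows ⟧) _) ⟩
        map proj₁ (filter SepAt? (map (_, j) ⟦ #rows ⟧) ++ _)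
          ≡⟨ List.map-++ proj₁ (filter SepAt? (map (_, j) ⟦ #rows ⟧)) _ ⟩
        map proj₁ (filter SepAt? (map (_, j) ⟦ #rows ⟧)) ++ _
          ≡⟨ cong₂ _++_
               (trans (cong (map proj₁) (filter-map SepAt? (λ i → SepAt? (i , j)) (_, j) (λ _ → id , id) ⟦ #rows ⟧))
                 (trans (sym (List.map-∘ (columnSeps j))) (List.map-id _)))
               (by-columns js) ⟩
        columnSeps j ++ concatMap columnSeps js ∎

    -- A column without 1's is labelled two at once; that it does contain a 2 comes from the absence
    -- of empty columns.
    columnLetter : ∀ {j} → Dec (InColumn S T 𝟙 j) → Dec (InColumn S T 𝟚 j) → Letter
    columnLetter (no _)  _       = two
    columnLetter (yes _) (no _)  = one
    columnLetter (yes _) (yes _) = star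

    letter : ℕ → Letter
    letter j = columnLetter (InColumn? S T 𝟙 j) (InColumn? S T 𝟚 j)

    letter-one : ∀ {j} → InColumn S T 𝟙 j → ¬ InColumn S T 𝟚 j → letter j ≡ one
    letter-one {j} p ¬q with InColumn? S T 𝟙 j | InColumn? S T 𝟚 j
    ... | no ¬p | _     = contradiction p ¬p
    ... | yes _ | no _  = refl
    ... | yes _ | yes q = contradiction q ¬q

    letter-two : ∀ {j} → ¬ InColumn S T 𝟙 j → letter j ≡ two
    letter-two {j} ¬p with InColumn? S T 𝟙 j
    ... | no _  = refl
    ... | yes p = contradiction p ¬p

    letter-star : ∀ {j} → InColumn S T 𝟙 j → InColumn S T 𝟚 j → letter j ≡ star
    letter-star {j} p q with InColumn? S T 𝟙 j | InColumn? S T 𝟚 j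
    ... | no ¬p | _     = contradiction p ¬p
    ... | yes _ | no ¬q = contradiction q ¬q
    ... | yes _ | yes _ = refl

    columnSeps-pure : ∀ {j} → (∀ {i} → ¬ SepAt (i , j)) → columnSeps j ≡ []
    columnSeps-pure {j} ¬sep = List.filter-none (λ i → SepAt? (i , j)) (All.universal (λ _ → ¬sep) ⟦ #rows ⟧)

    columnSeps-mixed : ∀ {i j} → SepAt (i , j) → (∀ {i′} → SepAt (i′ , j) → i′ ≡ i) → columnSeps j ≡ i ∷ []
    columnSeps-mixed {i} {j} sep only = filter-singleton (λ i → SepAt? (i , j)) (unique-⟦⟧ #rows)
      (∈-⟦⟧ (proj₁ (Shape⁻ c∈)) (row≤#rows c∈)) sep only
      where c∈ = At⇒Shape (proj₁ (SepAt⁻ sep))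

    word : List Letter
    word = map letter (columns 1 (width S))

-- A path changes its column by at most one per step, so on its way from column x to column x + 1 it
-- makes a horizontal step across their common boundary.
adjacent-columns-meet : ∀ S → Connected S → NoEmptyColumns S →
  ∀ x → 1 ≤ x → suc x ≤ width S → ∃ λ i → (i , x) ∈ Shape S × (i , suc x) ∈ Shape S
adjacent-columns-meet S connected columns≢∅ x 1≤x x<W
  with columns≢∅ x 1≤x (ℕ.<⇒≤ x<W) | columns≢∅ (suc x) (s≤s z≤n) x<W
... | i , c∈ | j , d∈ = cross (connected c∈ d∈) ℕ.≤-refl ℕ.≤-refl
  where
  cross : ∀ {c d} → Star (λ c d → c ∈ Shape S × d ∈ Shape S × Adjacent c d) c d →
    proj₂ c ≤ x → x < proj₂ d → ∃ λ i → (i , x) ∈ Shape S × (i , suc x) ∈ Shape S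
  cross ε c≤x x<c = contradiction c≤x (ℕ.<⇒≱ x<c)
  cross {i , j} (_◅_ {j = i′ , j′} (c∈ , e∈ , adj) p) j≤x x<d with ℕ.≤-<-connex j′ x
  ... | inj₁ j′≤x = cross p j′≤x x<d
  ... | inj₂ x<j′ with adj
  ...   | inj₂ (refl , _)           = contradiction j≤x (ℕ.<⇒≱ x<j′)
  ...   | inj₁ (refl , inj₂ refl)   = contradiction (ℕ.≤-trans (ℕ.n≤1+n _) j≤x) (ℕ.<⇒≱ x<j′)
  ...   | inj₁ (refl , inj₁ refl) with refl ← ℕ.≤-antisym j≤x (ℕ.≤-pred x<j′) = i , c∈ , e∈

-- Column types of an rpp.

module _ (S : SkewPartition) (T : Filling S) where
  open Geometry S

  Threshold : ℕ → ℕ → Set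
  Threshold j h = (∀ {i} → At S T 𝟙 i j → i ≤ h) × (∀ {i} → At S T 𝟚 i j → h < i)

  data ColumnView (j : ℕ) : Letter → List ℕ → Set where
    one  : (∀ {i} → ¬ At S T 𝟚 i j) → ColumnView j one []
    two  : (∀ {i} → ¬ At S T 𝟙 i j) → ColumnView j two []
    star : ∀ {i} → SepAt S T (i , j) → ColumnView j star (i ∷ [])

  module _ (rpp : IsRPP S T) where

    row-increasing : ∀ {i j j′} → At S T 𝟚 i j → At S T 𝟙 i j′ → ¬ j ≤ j′
    row-increasing (c , refl , t) (d , e , t′) j≤j′
      with () ← subst₂ Fin._≤_ t t′ (proj₁ rpp c d (sym (cong proj₁ e)) (subst (_ ≤_) (sym (cong proj₂ e)) j≤j′))

    column-increasing : ∀ {i i′ j} → At S T 𝟚 i j → At S T 𝟙 i′ j → ¬ i ≤ i′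
    column-increasing (c , refl , t) (d , e , t′) i≤i′
      with () ← subst₂ Fin._≤_ t t′ (proj₂ rpp c d (sym (cong proj₂ e)) (subst (_ ≤_) (sym (cong proj₁ e)) i≤i′))

    -- Descends from the 1 until the next entry is a 2; all cells in between belong to the shape
    -- because its columns are contiguous.
    sep-exists : ∀ {i i′ j} → At S T 𝟙 i j → At S T 𝟚 i′ j → ∃ λ k → SepAt S T (k , j)
    sep-exists {i} {i′} {j} one∈ two∈ with ≤⇒+ (ℕ.≰⇒> (column-increasing two∈ one∈))
    ... | n , n+ = go n i one∈ n+
      where
      go : ∀ n i → At S T 𝟙 i j → n + suc i ≡ i′ → ∃ λ k → SepAt S T (k , j)
      go zero    i one∈ refl = i , SepAt⁺ S T one∈ two∈
      go (suc n) i one∈ n+ with At-split S T below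
        where
        below : (suc i , j) ∈ Shape S
        below with 1≤i , _ , μ<j , _ ← Shape⁻ (At⇒Shape S T one∈) =
          Shape⁺ (s≤s z≤n) (ℕ.≤-<-trans (part-antitone (inner S) 1≤i (ℕ.n≤1+n i)) μ<j)
            (ℕ.≤-trans (proj₂ (proj₂ (proj₂ (Shape⁻ (At⇒Shape S T two∈)))))
              (part-antitone (outer S) (s≤s z≤n) (subst (suc i ≤_) n+ (ℕ.m≤n+m (suc i) (suc n)))))
      ... | inj₁ one∈′ = go n (suc i) one∈′ (trans (ℕ.+-suc n (suc i)) n+)
      ... | inj₂ two∈′ = i , SepAt⁺ S T one∈ two∈′

    sep-unique : ∀ {i i′ j} → SepAt S T (i , j) → SepAt S T (i′ , j) → i′ ≡ i
    sep-unique {i} {i′} s s′ with ℕ.<-cmp i i′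
    ... | tri≈ _ i≡i′ _ = sym i≡i′
    ... | tri< i<i′ _ _ =
      contradiction i<i′ (column-increasing (proj₂ (SepAt⁻ S T s)) (proj₁ (SepAt⁻ S T s′)))
    ... | tri> _ _ i′<i =
      contradiction i′<i (column-increasing (proj₂ (SepAt⁻ S T s′)) (proj₁ (SepAt⁻ S T s)))

    columnView : ∀ j → ColumnView j (letter S T j) (columnSeps S T j)
    columnView j with InColumn? S T 𝟙 j | InColumn? S T 𝟚 j
    ... | no ¬p | _ rewrite columnSeps-pure S T {j} (λ s → ¬p (At⇒InColumn S T (proj₁ (SepAt⁻ S T s)))) =
      two (λ at → ¬p (At⇒InColumn S T at))
    ... | yes p | no ¬q rewrite columnSeps-pure S T {j} (λ s → ¬q (At⇒InColumn S T (proj₂ (SepAt⁻ S T s)))) =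
      one (λ at → ¬q (At⇒InColumn S T at))
    ... | yes p | yes q
      with sep-exists (proj₂ (InColumn⇒At S T p)) (proj₂ (InColumn⇒At S T q))
    ...   | i , s rewrite columnSeps-mixed S T s (sep-unique s) = star s

    sep-threshold : ∀ {i j} → SepAt S T (i , j) → Threshold j i
    sep-threshold s =
        (λ at → ℕ.≤-pred (ℕ.≰⇒> (column-increasing (proj₂ (SepAt⁻ S T s)) at)))
      , (λ at → ℕ.≰⇒> (column-increasing at (proj₁ (SepAt⁻ S T s))))

  sepsFrom : ℕ → ℕ → List ℕ
  sepsFrom x d = concatMap (columnSeps S T) (columns x d)

  lettersFrom : ℕ → ℕ → List Letter
  lettersFrom x d = map (letter S T) (columns x d)

  ∈-sepsFrom : ∀ x d {i} → i ∈ˡ sepsFrom x d → ∃ λ y → x ≤ y × SepAt S T (i , y)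
  ∈-sepsFrom x d {i} i∈ = go d x (∈-concatMap⁻ (columnSeps S T) {xs = columns x d} i∈)
    where
    go : ∀ d x → Any (λ y → i ∈ˡ columnSeps S T y) (columns x d) → ∃ λ y → x ≤ y × SepAt S T (i , y)
    go (suc d) x (here i∈)  = x , ℕ.≤-refl , proj₂ (∈-filter⁻ (λ i → SepAt? S T (i , x)) {xs = ⟦ # outer S ⟧} i∈)
    go (suc d) x (there p) with go d (suc x) p
    ... | y , x<y , s = y , ℕ.<⇒≤ x<y , s

  sep-bounds : ∀ {i y} → SepAt S T (i , y) → innerPart i < y × y ≤ outerPart (suc i)
  sep-bounds s with SepAt⁻ S T s
  ... | at , at′ = proj₁ (proj₂ (proj₂ (Shape⁻ (At⇒Shape S T at))))
                 , proj₂ (proj₂ (proj₂ (Shape⁻ (At⇒Shape S T at′))))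

-- From rpps to valid words.

module Forward (S : SkewPartition) (connected : Connected S) (columns≢∅ : NoEmptyColumns S)
  (ν : Partition) (representable : Representable S ν)
  (T : Filling S) (rpp : IsRPP S T) where
  open Geometry S
  open Counts ν representable

  PlacedBefore : ℕ → Pred ℕ 0ℓ
  PlacedBefore x i = ∃ λ y → y < x × SepAt S T (i , y)

  PreviousTwo : Bool → ℕ → Set
  PreviousTwo p x = p ≡ true → ∃ λ x′ → suc x′ ≡ x × 1 ≤ x′ × (∀ {i} → ¬ At S T 𝟙 i x′)

  placed-later : ∀ {x} → ∀ {i} → PlacedBefore x i → PlacedBefore (suc x) i
  placed-later (y , y<x , s) = y , ℕ.m≤n⇒m≤1+n y<x , s

  placed⇒opened : ∀ {x i} → PlacedBefore (suc x) i → Opened (suc x) i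
  placed⇒opened (y , s≤s y≤x , s) = s≤s (ℕ.<-≤-trans (proj₁ (sep-bounds S T s)) y≤x)

  unplaced⇒unclosed : ∀ {x d i} → i ∈ˡ sepsFrom S T x d → ¬ Closed x i
  unplaced⇒unclosed {x} {d} i∈ λ<x with ∈-sepsFrom S T x d i∈
  ... | y , x≤y , s = ℕ.<⇒≱ λ<x (ℕ.≤-trans x≤y (proj₂ (sep-bounds S T s)))

  module _ {x : ℕ} (no-2 : ∀ {i} → ¬ At S T 𝟚 i x) where

    -- If the support of i reached x, the cell (i + 1, x) would hold a 1, to the right of the 2
    -- below the separator i.
    pure-1⇒closed : ∀ {i} → PlacedBefore x i → Closed x i
    pure-1⇒closed {i} (y , y<x , s) with SepAt⁻ S T s
    ... | _ , at-2 = ℕ.≰⇒> λ x≤λ → impossible (At-split S T (cell x≤λ))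
      where
      cell : x ≤ outerPart (suc i) → (suc i , x) ∈ Shape S
      cell = Shape⁺ (s≤s z≤n) (ℕ.<-trans (proj₁ (proj₂ (proj₂ (Shape⁻ (At⇒Shape S T at-2))))) y<x)
      impossible : ¬ (At S T 𝟙 (suc i) x ⊎ At S T 𝟚 (suc i) x)
      impossible (inj₁ at) = row-increasing S T rpp at-2 at (ℕ.<⇒≤ y<x)
      impossible (inj₂ at) = no-2 at

  module _ {x : ℕ} (no-1 : ∀ {i} → ¬ At S T 𝟙 i x) where

    -- If the support of i began at or before x, the cell (i, x) would hold a 2, to the left of the
    -- 1 at the separator i.
    pure-2⇒unopened : ∀ {d i} → i ∈ˡ sepsFrom S T (suc x) d → ¬ Opened (suc x) i
    pure-2⇒unopened {d} {i} i∈ (s≤s μ<x) with ∈-sepsFrom S T (suc x) d i∈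
    ... | y , x<y , s with SepAt⁻ S T s
    ...   | at-1 , _ with Shape⁻ (At⇒Shape S T at-1)
    ...     | 1≤i , _ , _ , y≤λ = impossible (At-split S T (Shape⁺ 1≤i μ<x (ℕ.≤-trans (ℕ.<⇒≤ x<y) y≤λ)))
      where
      impossible : ¬ (At S T 𝟙 i x ⊎ At S T 𝟚 i x)
      impossible (inj₁ at) = no-1 at
      impossible (inj₂ at) = row-increasing S T rpp at at-1 (ℕ.<⇒≤ x<y)

    no-2-then-1 : 1 ≤ x → suc x ≤ W → ¬ (∀ {i} → ¬ At S T 𝟚 i (suc x))
    no-2-then-1 1≤x x<W no-2 with adjacent-columns-meet S connected columns≢∅ x 1≤x x<W
    ... | i , c∈ , d∈ = impossible (At-split S T c∈) (At-split S T d∈)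
      where
      impossible : At S T 𝟙 i x ⊎ At S T 𝟚 i x → ¬ (At S T 𝟙 i (suc x) ⊎ At S T 𝟚 i (suc x))
      impossible (inj₁ at) _          = no-1 at
      impossible (inj₂ _)  (inj₂ at)  = no-2 at
      impossible (inj₂ at) (inj₁ at′) = row-increasing S T rpp at at′ (ℕ.n≤1+n x)

  module _ {pre post : List ℕ} (eq : parts ν ≡ pre ++ post)
    {P : Pred ℕ 0ℓ} (P? : Decidable P) where

    pre≤count : All P pre → length pre ≤ count P? (parts ν)
    pre≤count ps = subst (λ is → length pre ≤ count P? is) (sym eq) (count≥ P? post ps)

    count≤pre : (∀ {i} → i ∈ˡ post → ¬ P i) → count P? (parts ν) ≤ length pre
    count≤pre ¬ps = subst (λ is → count P? is ≤ length pre) (sym eq) (count≤ P? pre (All.tabulate ¬ps))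

  -- `pre` lists the separators left of x, so α is its length. The conditions on α follow by
  -- counting over the split of ν: facts about `pre` bound α by `L` or `U` from above, facts about
  -- the remaining entries bound it from below.
  valid-from : ∀ d x p pre → parts ν ≡ pre ++ sepsFrom S T x d → 1 ≤ x → d + x ≡ suc W →
    All (PlacedBefore x) pre → PreviousTwo p x → Valid d x (length pre) p (lettersFrom S T x d)

  valid-step : ∀ d x p pre {l seps} → ColumnView S T x l seps →
    parts ν ≡ pre ++ seps ++ sepsFrom S T (suc x) d → (∀ {i} → i ∈ˡ seps ++ sepsFrom S T (suc x) d → ¬ Closed x i) →
    1 ≤ x → suc d + x ≡ suc W → All (PlacedBefore x) pre → PreviousTwo p x →
    Valid (suc d) x (length pre) p (l ∷ lettersFrom S T (suc x) d)

  valid-from zero x p pre eq _ _ _ _ =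
    end (cong length (trans (sym (List.++-identityʳ pre)) (sym eq)))
  valid-from (suc d) x p pre eq 1≤x d+x placed prev =
    valid-step d x p pre (columnView S T rpp x) eq (unplaced⇒unclosed {x} {suc d}) 1≤x d+x placed prev

  valid-step d x false pre (one no-2) eq unclosed 1≤x d+x placed prev = one
    (ℕ.≤-antisym (pre≤count eq (Closed? x) (All.map (pure-1⇒closed no-2) placed))
                 (count≤pre eq (Closed? x) unclosed))
    (valid-from d (suc x) false pre eq (s≤s z≤n) (trans (ℕ.+-suc d x) d+x)
      (All.map placed-later placed) (λ ()))
  valid-step d x true pre (one no-2) eq unclosed 1≤x d+x placed prev with prev refl
  ... | x′ , refl , 1≤x′ , no-1 = ⊥-elim (no-2-then-1 no-1 1≤x′
    (ℕ.≤-pred (subst (suc (suc x′) ≤_) d+x (s≤s (ℕ.m≤n+m (suc x′) d)))) no-2)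
  valid-step d x p pre (two no-1) eq unclosed 1≤x d+x placed prev = two
    (ℕ.≤-antisym (pre≤count eq (Opened? (suc x)) (All.map (placed⇒opened ∘ placed-later) placed))
                 (count≤pre eq (Opened? (suc x)) (pure-2⇒unopened no-1 {d})))
    (valid-from d (suc x) true pre eq (s≤s z≤n) (trans (ℕ.+-suc d x) d+x)
      (All.map placed-later placed) (λ _ → x , refl , 1≤x , no-1))
  valid-step d x p pre (star {i} s) eq unclosed 1≤x d+x placed prev = star
    (count≤pre eq (Closed? x) unclosed)
    (subst (_≤ L (suc x)) len (pre≤count eq′ (Opened? (suc x)) (All.map placed⇒opened placed′)))
    (subst (λ n → Valid d (suc x) n false (lettersFrom S T (suc x) d)) len
      (valid-from d (suc x) false (pre ++ i ∷ []) eq′ (s≤s z≤n) (trans (ℕ.+-suc d x) d+x) placed′ (λ ())))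
    where
    len : length (pre ++ i ∷ []) ≡ suc (length pre)
    len = trans (List.length-++ pre) (ℕ.+-comm (length pre) 1)
    eq′ : parts ν ≡ (pre ++ i ∷ []) ++ sepsFrom S T (suc x) d
    eq′ = trans eq (sym (List.++-assoc pre (i ∷ []) _))
    placed′ : All (PlacedBefore (suc x)) (pre ++ i ∷ [])
    placed′ = All.++⁺ (All.map placed-later placed) ((x , ℕ.≤-refl , s) ∷ [])

  word-valid : seplist S T ≡ parts ν → Valid W 1 0 false (word S T)
  word-valid eq = valid-from W 1 false [] (trans (sym eq) (seplist≡ S T)) ℕ.≤-refl (ℕ.+-comm W 1) [] (λ ())

-- Fillings from words

-- The last row of 1's in each column; for a pure column any bound beyond the column will do, so
-- the number R of rows and 0 are used.
heights : ℕ → List Letter → List ℕ → ℕ → ℕ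
heights R []         is       n       = 0
heights R (one ∷ w)  is       zero    = R
heights R (one ∷ w)  is       (suc n) = heights R w is n
heights R (two ∷ w)  is       zero    = 0
heights R (two ∷ w)  is       (suc n) = heights R w is n
heights R (star ∷ w) []       n       = 0
heights R (star ∷ w) (i ∷ is) zero    = i
heights R (star ∷ w) (i ∷ is) (suc n) = heights R w is n

module _ (S : SkewPartition) where
  open Geometry S

  column-index : ∀ c → ∃ λ n → n < width S × col S c ≡ suc n
  column-index c with coords S c | coords∈Shape S c
  ... | i , suc n | c∈ = n , column≤width S {i} c∈ , refl
  ... | i , zero  | c∈ = contradiction (proj₁ (proj₂ (Shape⁻ c∈))) λ ()

  threshold-unique : ∀ (T T′ : Filling S) {c h} → Threshold S T (col S c) h → Threshold S T′ (col S c) h →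
    T c ≡ T′ c
  threshold-unique T T′ {c} (t₁ , t₂) (t₁′ , t₂′) with T c in e | T′ c in e′
  ... | 𝟙 | 𝟙 = refl
  ... | 𝟚 | 𝟚 = refl
  ... | 𝟙 | 𝟚 = contradiction (t₁ (c , refl , e)) (ℕ.<⇒≱ (t₂′ (c , refl , e′)))
  ... | 𝟚 | 𝟙 = contradiction (t₁′ (c , refl , e′)) (ℕ.<⇒≱ (t₂ (c , refl , e)))

  module _ (T : Filling S) (rpp : IsRPP S T) where

    threshold-view : ∀ {x l seps} → ColumnView S T x l seps → ∀ w is →
      Threshold S T x (heights (#rows S) (l ∷ w) (seps ++ is) 0)
    threshold-view (one no-2) w is = (λ at → row≤#rows S (At⇒Shape S T at)) , λ at → contradiction at no-2
    threshold-view (two no-1) w is = (λ at → contradiction at no-1) , λ at → proj₁ (Shape⁻ (At⇒Shape S T at))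
    threshold-view (star s)   w is = sep-threshold S T rpp s

    heights-view : ∀ {x l seps} → ColumnView S T x l seps → ∀ w is n →
      heights (#rows S) (l ∷ w) (seps ++ is) (suc n) ≡ heights (#rows S) w is n
    heights-view (one _)  w is n = refl
    heights-view (two _)  w is n = refl
    heights-view (star _) w is n = refl

    threshold-from : ∀ d x n → n < d →
      Threshold S T (n + x) (heights (#rows S) (lettersFrom S T x d) (sepsFrom S T x d) n)
    threshold-from (suc d) x zero    _ = threshold-view (columnView S T rpp x) _ _
    threshold-from (suc d) x (suc n) (s≤s n<d) = subst₂ (Threshold S T) (ℕ.+-suc n x)
      (sym (heights-view (columnView S T rpp x) _ _ n)) (threshold-from d (suc x) n n<d)

    rpp-threshold : ∀ {is} → seplist S T ≡ is → ∀ n → n < width S →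
      Threshold S T (suc n) (heights (#rows S) (word S T) is n)
    rpp-threshold refl n n<W = subst₂ (Threshold S T) (ℕ.+-comm n 1)
      (cong (λ is → heights (#rows S) (word S T) is n) (sym (seplist≡ S T))) (threshold-from (width S) 1 n n<W)

  -- The word and the separators determine `heights`, and a threshold in each column determines
  -- every entry.
  word-injective : ∀ {T T′ is} → IsRPP S T → IsRPP S T′ → seplist S T ≡ is → seplist S T′ ≡ is →
    word S T ≡ word S T′ → ∀ c → T c ≡ T′ c
  word-injective {T} {T′} {is} rpp rpp′ e e′ w c with column-index c
  ... | n , n<W , c≡ = threshold-unique T T′
    (subst (λ j → Threshold S T j (heights (#rows S) (word S T) is n)) (sym c≡) (rpp-threshold T rpp e n n<W))
    (subst₂ (Threshold S T′) (sym c≡) (cong (λ w → heights (#rows S) w is n) (sym w)) (rpp-threshold T′ rpp′ e′ n n<W))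

module Backward (S : SkewPartition) (columns≢∅ : NoEmptyColumns S)
  (ν : Partition) (representable : Representable S ν) where
  open Geometry S
  open Counts ν representable

  module _ {pre is : List ℕ} {i : ℕ} (eq : parts ν ≡ pre ++ i ∷ is) where

    private
      opened-closed′ : ∀ x → InitiallyClosed (Opened? x) (pre ++ i ∷ is)
      opened-closed′ x = subst (InitiallyClosed (Opened? x)) eq (opened-closed x)
      closed-closed′ : ∀ x → InitiallyClosed (Closed? x) (pre ++ i ∷ is)
      closed-closed′ x = subst (InitiallyClosed (Closed? x)) eq (closed-closed x)

    -- The opened entries form a prefix of ν, so comparing α = length pre with `L x` decides whether
    -- the next entry i is opened. The three lemmas that follow use the same principle, two of them
    -- with `U` and closed entries.
    <L⇒opened : ∀ x → length pre < L x → Opened x i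
    <L⇒opened x <L with Opened? x i
    ... | yes o = o
    ... | no ¬o = contradiction (count-closed-no (Opened? x) pre (opened-closed′ x) ¬o)
      (ℕ.<⇒≱ (subst (λ ps → length pre < count (Opened? x) ps) eq <L))

    L≤⇒unopened : ∀ x → L x ≤ length pre → ¬ Opened x i
    L≤⇒unopened x L≤ o = ℕ.<⇒≱ (count-closed-yes (Opened? x) pre (opened-closed′ x) o)
      (subst (λ ps → count (Opened? x) ps ≤ length pre) eq L≤)

    <U⇒closed : ∀ x → length pre < U x → Closed x i
    <U⇒closed x <U with Closed? x i
    ... | yes o = o
    ... | no ¬o = contradiction (count-closed-no (Closed? x) pre (closed-closed′ x) ¬o)
      (ℕ.<⇒≱ (subst (λ ps → length pre < count (Closed? x) ps) eq <U))

    U≤⇒unclosed : ∀ x → U x ≤ length pre → ¬ Closed x i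
    U≤⇒unclosed x U≤ o = ℕ.<⇒≱ (count-closed-yes (Closed? x) pre (closed-closed′ x) o)
      (subst (λ ps → count (Closed? x) ps ≤ length pre) eq U≤)

    1≤entry : 1 ≤ i
    1≤entry = proj₁ (All.head (All.++⁻ʳ pre (subst (All _) eq nonempty)))

    next-pre : parts ν ≡ (pre ++ i ∷ []) ++ is
    next-pre = trans eq (sym (List.++-assoc pre (i ∷ []) is))

    next-length : suc (length pre) ≡ length (pre ++ i ∷ [])
    next-length = sym (trans (List.length-++ pre) (ℕ.+-comm (length pre) 1))

    star⇒supp : ∀ {x} → U x ≤ length pre → suc (length pre) ≤ L (suc x) → x ∈ supp S i
    star⇒supp {x} U≤ ≤L = supp⁺ 1≤entry (ℕ.≤-pred (<L⇒opened (suc x) ≤L)) (ℕ.≮⇒≥ (U≤⇒unclosed x U≤))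

  no-star-at-end : ∀ {pre x} → parts ν ≡ pre ++ [] → ¬ suc (length pre) ≤ L x
  no-star-at-end {pre} {x} eq ≤L = ℕ.<⇒≱ ≤L (ℕ.≤-trans (L≤s x)
    (ℕ.≤-reflexive (cong length (trans eq (List.++-identityʳ pre)))))

  module _ (T : Filling S) where

    private
      thresholds-tail : ∀ d x (h : ℕ → ℕ) → (∀ n → n < suc d → Threshold S T (n + x) (h n)) →
        ∀ n → n < d → Threshold S T (n + suc x) (h (suc n))
      thresholds-tail d x h thr n n<d =
        subst (λ y → Threshold S T y (h (suc n))) (sym (ℕ.+-suc n x)) (thr (suc n) (s≤s n<d))

      Determined : ℕ → ℕ → List Letter → List ℕ → Set
      Determined x d w is = lettersFrom S T x d ≡ w × sepsFrom S T x d ≡ is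

      determined-∷ : ∀ {d x l seps w is} → letter S T x ≡ l → columnSeps S T x ≡ seps →
        Determined (suc x) d w is → Determined x (suc d) (l ∷ w) (seps ++ is)
      determined-∷ refl refl (refl , refl) = refl , refl

    module _ {x : ℕ} where

      one-column : 1 ≤ x → x ≤ W → Threshold S T x (#rows S) → letter S T x ≡ one × columnSeps S T x ≡ []
      one-column 1≤x x≤W t = letter-one S T in-1 (λ q → no-2 (proj₂ (InColumn⇒At S T q)))
                           , columnSeps-pure S T (λ s → no-2 (proj₂ (SepAt⁻ S T s)))
        where
        no-2 : ∀ {i} → ¬ At S T 𝟚 i x
        no-2 at = ℕ.<⇒≱ (proj₂ t at) (row≤#rows S (At⇒Shape S T at))
        in-1 : InColumn S T 𝟙 x
        in-1 with columns≢∅ x 1≤x x≤W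
        ... | i , c∈ with At-split S T c∈
        ...   | inj₁ at = At⇒InColumn S T at
        ...   | inj₂ at = contradiction at no-2

      two-column : Threshold S T x 0 → letter S T x ≡ two × columnSeps S T x ≡ []
      two-column t = letter-two S T (λ q → no-1 (proj₂ (InColumn⇒At S T q)))
                   , columnSeps-pure S T (λ s → no-1 (proj₁ (SepAt⁻ S T s)))
        where
        no-1 : ∀ {i} → ¬ At S T 𝟙 i x
        no-1 at = ℕ.<⇒≱ (proj₁ (Shape⁻ (At⇒Shape S T at))) (proj₁ t at)

      star-column : ∀ {i} → x ∈ supp S i → Threshold S T x i → letter S T x ≡ star × columnSeps S T x ≡ i ∷ []
      star-column {i} (c∈ , d∈) t = letter-star S T (At⇒InColumn S T at-1) (At⇒InColumn S T at-2)
                                  , columnSeps-mixed S T (SepAt⁺ S T at-1 at-2) only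
        where
        at-1 : At S T 𝟙 i x
        at-1 with At-split S T c∈
        ... | inj₁ at = at
        ... | inj₂ at = contradiction (proj₂ t at) ℕ.1+n≰n
        at-2 : At S T 𝟚 (suc i) x
        at-2 with At-split S T d∈
        ... | inj₁ at = contradiction (proj₁ t at) ℕ.1+n≰n
        ... | inj₂ at = at
        only : ∀ {i′} → SepAt S T (i′ , x) → i′ ≡ i
        only s with SepAt⁻ S T s
        ... | a₁ , a₂ = ℕ.≤-antisym (proj₁ t a₁) (ℕ.≤-pred (proj₂ t a₂))

    -- At a star the bounds on α place column x in the support of the next entry of ν. So both cells
    -- around the threshold exist, and the column reads back as mixed with exactly this separator.
    columns-determined : ∀ {d x α p w} pre is → Valid d x α p w → α ≡ length pre → parts ν ≡ pre ++ is →
      1 ≤ x → d + x ≡ suc W → (∀ n → n < d → Threshold S T (n + x) (heights (#rows S) w is n)) →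
      Determined x d w is
    columns-determined pre [] (end α≡s) α≡ eq 1≤x d+x thr = refl , refl
    columns-determined pre (i ∷ is) (end refl) α≡ eq 1≤x d+x thr = contradiction
      (trans (sym α≡) (trans (cong length eq) (List.length-++ pre)))
      (ℕ.<⇒≢ (subst (length pre <_) (sym (ℕ.+-suc (length pre) (length is))) (s≤s (ℕ.m≤m+n _ _))))
    columns-determined {suc d} {x} {w = one ∷ w} pre is (one α≡U v) α≡ eq 1≤x d+x thr =
      determined-∷ {d} (proj₁ at-x) (proj₂ at-x)
        (columns-determined pre is v α≡ eq (s≤s z≤n) (trans (ℕ.+-suc d x) d+x)
          (thresholds-tail d x (heights (#rows S) (one ∷ w) is) thr))
      where
      at-x : letter S T x ≡ one × columnSeps S T x ≡ []
      at-x = one-column 1≤x (subst (x ≤_) (ℕ.suc-injective d+x) (ℕ.m≤n+m x d)) (thr 0 (s≤s z≤n))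
    columns-determined {suc d} {x} {w = two ∷ w} pre is (two α≡L v) α≡ eq 1≤x d+x thr =
      determined-∷ {d} (proj₁ at-x) (proj₂ at-x)
        (columns-determined pre is v α≡ eq (s≤s z≤n) (trans (ℕ.+-suc d x) d+x)
          (thresholds-tail d x (heights (#rows S) (two ∷ w) is) thr))
      where
      at-x : letter S T x ≡ two × columnSeps S T x ≡ []
      at-x = two-column (thr 0 (s≤s z≤n))
    columns-determined {suc d} {x} pre [] (star U≤ ≤L v) refl eq 1≤x d+x thr =
      contradiction ≤L (no-star-at-end {pre} {suc x} eq)
    columns-determined {suc d} {x} {w = star ∷ w} pre (i ∷ is) (star U≤ ≤L v) refl eq 1≤x d+x thr =
      determined-∷ {d} (proj₁ at-x) (proj₂ at-x)
        (columns-determined (pre ++ i ∷ []) is v (next-length eq) (next-pre eq) (s≤s z≤n)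
          (trans (ℕ.+-suc d x) d+x) (thresholds-tail d x (heights (#rows S) (star ∷ w) (i ∷ is)) thr))
      where
      at-x : letter S T x ≡ star × columnSeps S T x ≡ i ∷ []
      at-x = star-column (star⇒supp eq U≤ ≤L) (thr 0 (s≤s z≤n))

  InBoth : ℕ → ℕ → Set
  InBoth i x = (i , x) ∈ Shape S × (i , suc x) ∈ Shape S

  -- Only the letters of the two neighbouring columns matter. After a two, a one is excluded by the
  -- flag, and the separator of a star is unopened, so a common row lies strictly below it. After a
  -- star, a one means that the separator is already closed, so no common row lies below it; two
  -- stars are in order because ν decreases.
  heights-descend : ∀ {d x α p w} pre is → Valid d x α p w → α ≡ length pre → parts ν ≡ pre ++ is →
    ∀ n → suc n < d → ∀ {i} → InBoth i (n + x) →
    i ≤ heights (#rows S) w is (suc n) → i ≤ heights (#rows S) w is n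
  heights-descend {x = x} pre is (one _ v) α≡ eq (suc n) (s≤s n<d) {i} both =
    heights-descend pre is v α≡ eq n n<d (subst (InBoth i) (sym (ℕ.+-suc n x)) both)
  heights-descend {x = x} pre is (two _ v) α≡ eq (suc n) (s≤s n<d) {i} both =
    heights-descend pre is v α≡ eq n n<d (subst (InBoth i) (sym (ℕ.+-suc n x)) both)
  heights-descend {x = x} pre [] (star _ _ v) α≡ eq n n<d both i≤ = ℕ.≤-trans i≤ z≤n
  heights-descend {x = x} pre (k ∷ is) (star _ _ v) α≡ eq (suc n) (s≤s n<d) {i} both =
    heights-descend (pre ++ k ∷ []) is v (trans (cong suc α≡) (next-length eq)) (next-pre eq) n n<d
      (subst (InBoth i) (sym (ℕ.+-suc n x)) both)
  heights-descend pre is (one _ v) α≡ eq zero n<d both i≤ = row≤#rows S (proj₁ both)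
  heights-descend pre is (two _ (end _)) α≡ eq zero (s≤s ())
  heights-descend pre (k ∷ is) (star _ _ (end _)) α≡ eq zero (s≤s ())
  heights-descend pre is (two _ (two _ v)) α≡ eq zero n<d both i≤ = i≤
  heights-descend pre [] (two _ (star _ _ v)) α≡ eq zero n<d both i≤ = i≤
  heights-descend {x = x} pre (k ∷ is) (two α≡L (star _ _ v)) refl eq zero n<d both i≤ =
    contradiction (s≤s (ℕ.≤-<-trans (part-antitone (inner S) (proj₁ (Shape⁻ (proj₁ both))) i≤)
                                    (proj₁ (proj₂ (proj₂ (Shape⁻ (proj₁ both)))))))
      (L≤⇒unopened eq (suc x) (ℕ.≤-reflexive (sym α≡L)))
  heights-descend {x = x} pre (k ∷ is) (star _ _ (one 1+α≡U v)) refl eq zero n<d {i} both i≤ =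
    ℕ.≮⇒≥ λ k<i → ℕ.<⇒≱ (<U⇒closed eq (suc x) (ℕ.≤-reflexive 1+α≡U))
      (ℕ.≤-trans (proj₂ (proj₂ (proj₂ (Shape⁻ (proj₂ both))))) (part-antitone (outer S) (s≤s z≤n) k<i))
  heights-descend pre (k ∷ is) (star _ _ (two _ v)) α≡ eq zero n<d both i≤ = ℕ.≤-trans i≤ z≤n
  heights-descend pre (k ∷ []) (star _ _ (star _ _ v)) α≡ eq zero n<d both i≤ = ℕ.≤-trans i≤ z≤n
  heights-descend pre (k ∷ k′ ∷ is) (star _ _ (star _ _ v)) α≡ eq zero n<d both i≤ =
    ℕ.≤-trans i≤ (second pre (subst (AllPairs _) eq
      (Linked.Linked⇒AllPairs (λ p q → ℕ.≤-trans q p) (decreasing ν))))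
    where
    second : ∀ pre {k k′ is} → AllPairs _≥_ (pre ++ k ∷ k′ ∷ is) → k′ ≤ k
    second []        ((k≥k′ ∷ _) ∷ _) = k≥k′
    second (_ ∷ pre) (_ ∷ ps)         = second pre ps

  module _ (w : List Letter) (valid : Valid W 1 0 false w) where

    height : ℕ → ℕ
    height = heights (#rows S) w (parts ν)

    entry : ∀ {P : Set} → Dec P → Entry
    entry (yes _) = 𝟙
    entry (no _)  = 𝟚

    build : Filling S
    -- Columns are numbered from 1, the values of `height` from 0.
    build c = entry (row S c ≤? height (col S c ∸ 1))

    entry-𝟙 : ∀ {P : Set} (P? : Dec P) → entry P? ≡ 𝟙 → P
    entry-𝟙 (yes p) _ = p

    entry-𝟚 : ∀ {P : Set} (P? : Dec P) → entry P? ≡ 𝟚 → ¬ P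
    entry-𝟚 (no ¬p) _ = ¬p

    -- The enumeration of fillings produces a function that agrees with `build` only pointwise, so
    -- the properties are proved for any such T.
    module _ (T : Filling S) (T≗build : ∀ c → T c ≡ build c) where

      build-threshold : ∀ n → Threshold S T (suc n) (height n)
      build-threshold n = below , above
        where
        below : ∀ {i} → At S T 𝟙 i (suc n) → i ≤ height n
        below (c , c≡ , t) = subst (λ (i , j) → i ≤ height (j ∸ 1)) c≡
          (entry-𝟙 (row S c ≤? height (col S c ∸ 1)) (trans (sym (T≗build c)) t))
        above : ∀ {i} → At S T 𝟚 i (suc n) → height n < i
        above (c , c≡ , t) = ℕ.≰⇒> λ i≤ →
          entry-𝟚 (row S c ≤? height (col S c ∸ 1)) (trans (sym (T≗build c)) t)
            (subst (λ (i , j) → i ≤ height (j ∸ 1)) (sym c≡) i≤)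

      height-antitone : ∀ {i} k n → (i , suc n) ∈ Shape S → (i , suc (k + n)) ∈ Shape S →
        i ≤ height (k + n) → i ≤ height n
      height-antitone zero    n c∈ d∈ i≤ = i≤
      height-antitone {i} (suc k) n c∈ d∈ i≤ with Shape⁻ c∈ | Shape⁻ d∈
      ... | 1≤i , _ , μ< , _ | _ , _ , _ , ≤λ = height-antitone k n c∈ between
        (heights-descend [] (parts ν) valid refl refl (k + n) (column≤width S {i} d∈)
          (subst (InBoth i) (ℕ.+-comm 1 (k + n)) (between , d∈)) i≤)
        where
        between : (i , suc (k + n)) ∈ Shape S
        between = Shape⁺ 1≤i (ℕ.<-≤-trans μ< (s≤s (ℕ.m≤n+m n k))) (ℕ.≤-trans (ℕ.n≤1+n _) ≤λ)

      no-descent : ∀ {i n m} → At S T 𝟚 i (suc n) → At S T 𝟙 i (suc m) → ¬ n ≤ m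
      no-descent {i} {n} at at′ n≤m with ≤⇒+ n≤m
      ... | k , refl = ℕ.<⇒≱ (proj₂ (build-threshold n) at)
        (height-antitone k n (At⇒Shape S T at) (At⇒Shape S T at′) (proj₁ (build-threshold (k + n)) at′))

      ≤-entries : ∀ {e e′ : Entry} → ¬ (e ≡ 𝟚 × e′ ≡ 𝟙) → e Fin.≤ e′
      ≤-entries {𝟙}      _ = z≤n
      ≤-entries {𝟚} {𝟙} f = contradiction (refl , refl) f
      ≤-entries {𝟚} {𝟚} _ = ℕ.≤-refl

      build-rpp : IsRPP S T
      build-rpp = (λ c d r≡ c≤d → ≤-entries (rows c d r≡ c≤d)) , (λ c d c≡ r≤d → ≤-entries (cols c d c≡ r≤d))
        where
        at : ∀ c {e n} → col S c ≡ suc n → T c ≡ e → At S T e (row S c) (suc n)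
        at c c≡ t = c , cong (row S c ,_) c≡ , t
        rows : ∀ c d → row S c ≡ row S d → col S c ≤ col S d → ¬ (T c ≡ 𝟚 × T d ≡ 𝟙)
        rows c d r≡ c≤d (t , t′) = descent (column-index S c) (column-index S d)
          where
          descent : (∃ λ n → n < W × col S c ≡ suc n) → ¬ (∃ λ m → m < W × col S d ≡ suc m)
          descent (n , _ , ce) (m , _ , de) = no-descent (at c ce t)
            (subst (λ i → At S T 𝟙 i (suc m)) (sym r≡) (at d de t′)) (ℕ.≤-pred (subst₂ _≤_ ce de c≤d))
        cols : ∀ c d → col S c ≡ col S d → row S c ≤ row S d → ¬ (T c ≡ 𝟚 × T d ≡ 𝟙)
        cols c d c≡ r≤ (t , t′) = inversion (column-index S d)
          where
          inversion : ¬ (∃ λ m → m < W × col S d ≡ suc m)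
          inversion (m , _ , de) = ℕ.<⇒≱ (proj₂ (build-threshold m) (at c (trans c≡ de) t))
            (ℕ.≤-trans r≤ (proj₁ (build-threshold m) (at d de t′)))

      build-determined : word S T ≡ w × seplist S T ≡ parts ν
      build-determined = proj₁ determined , trans (seplist≡ S T) (proj₂ determined)
        where
        determined = columns-determined T [] (parts ν) valid refl refl ℕ.≤-refl (ℕ.+-comm W 1)
          (λ n _ → subst (λ y → Threshold S T y (height n)) (ℕ.+-comm 1 n) (build-threshold n))

-- Counting

funToFin-cong : ∀ {m n} {f g : Fin m → Fin n} → f ≗ g → funToFin f ≡ funToFin g
funToFin-cong {zero}  e = refl
funToFin-cong {suc m} e = cong₂ combine (e Fin.zero) (funToFin-cong (e ∘ Fin.suc))

finToFun-injective : ∀ {m n} {i j : Fin (n ℕ.^ m)} → finToFun {n} {m} i ≗ finToFun j → i ≡ j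
finToFun-injective {m} {n} {i} {j} e =
  trans (sym (Fin.funToFin-finToFin {m} {n} i)) (trans (funToFin-cong e) (Fin.funToFin-finToFin {m} {n} j))

module _ (S : SkewPartition) (columns≢∅ : NoEmptyColumns S) (T : Filling S) (rpp : IsRPP S T) where
  open Geometry S

  inColumns : Entry → List ℕ → ℕ
  inColumns e js = count (InColumn? S T e) js

  column-counts : ∀ {x l seps} → 1 ≤ x → x ≤ width S → ColumnView S T x l seps → ∀ js →
    (inColumns 𝟙 (x ∷ js) , inColumns 𝟚 (x ∷ js))
      ≡ (length seps , length seps) ∔ letterWeight l ∔ (inColumns 𝟙 js , inColumns 𝟚 js)
  column-counts {x} 1≤x x≤W (star s) js = cong₂ _,_
    (count-∷-yes (InColumn? S T 𝟙) {xs = js} (At⇒InColumn S T (proj₁ (SepAt⁻ S T s))))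
    (count-∷-yes (InColumn? S T 𝟚) {xs = js} (At⇒InColumn S T (proj₂ (SepAt⁻ S T s))))
  column-counts {x} 1≤x x≤W (one no-2) js = cong₂ _,_
    (count-∷-yes (InColumn? S T 𝟙) {xs = js} in-1)
    (count-∷-no (InColumn? S T 𝟚) {xs = js} λ q → no-2 (proj₂ (InColumn⇒At S T q)))
    where
    in-1 : InColumn S T 𝟙 x
    in-1 with columns≢∅ x 1≤x x≤W
    ... | i , c∈ with At-split S T c∈
    ...   | inj₁ at = At⇒InColumn S T at
    ...   | inj₂ at = contradiction at no-2
  column-counts {x} 1≤x x≤W (two no-1) js = cong₂ _,_
    (count-∷-no (InColumn? S T 𝟙) {xs = js} λ q → no-1 (proj₂ (InColumn⇒At S T q)))
    (count-∷-yes (InColumn? S T 𝟚) {xs = js} in-2)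
    where
    in-2 : InColumn S T 𝟚 x
    in-2 with columns≢∅ x 1≤x x≤W
    ... | i , c∈ with At-split S T c∈
    ...   | inj₁ at = contradiction at no-1
    ...   | inj₂ at = At⇒InColumn S T at

  counts-from : ∀ d x → 1 ≤ x → d + x ≡ suc (width S) →
    (inColumns 𝟙 (columns x d) , inColumns 𝟚 (columns x d))
      ≡ (length (sepsFrom S T x d) , length (sepsFrom S T x d)) ∔ weight (lettersFrom S T x d)
  counts-from zero    x 1≤x d+x = refl
  counts-from (suc d) x 1≤x d+x = begin
    (inColumns 𝟙 (x ∷ js) , inColumns 𝟚 (x ∷ js))
      ≡⟨ column-counts 1≤x (subst (x ≤_) (ℕ.suc-injective d+x) (ℕ.m≤n+m x d)) (columnView S T rpp x) js ⟩
    (k , k) ∔ letterWeight l ∔ (inColumns 𝟙 js , inColumns 𝟚 js)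
      ≡⟨ cong ((k , k) ∔ letterWeight l ∔_) (counts-from d (suc x) (s≤s z≤n) (trans (ℕ.+-suc d x) d+x)) ⟩
    (k , k) ∔ letterWeight l ∔ ((m , m) ∔ weight (lettersFrom S T (suc x) d))
      ≡⟨ cong₂ _,_ (interchange k (proj₁ (letterWeight l)) m _) (interchange k (proj₂ (letterWeight l)) m _) ⟩
    (k + m , k + m) ∔ (letterWeight l ∔ weight (lettersFrom S T (suc x) d))
      ≡⟨ cong (λ n → (n , n) ∔ weight (lettersFrom S T x (suc d)))
           (sym (List.length-++ (columnSeps S T x))) ⟩
    (length (sepsFrom S T x (suc d)) , length (sepsFrom S T x (suc d))) ∔ weight (lettersFrom S T x (suc d)) ∎
    where
    open ≡-Reasoning
    js = columns (suc x) d
    l = letter S T x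
    k = length (columnSeps S T x)
    m = length (sepsFrom S T (suc x) d)
    interchange : ∀ a b c d → a + b + (c + d) ≡ a + c + (b + d)
    interchange = ℕ-solve-∀

  -- A mixed column holds exactly one separator and counts for both entries, so the mixed columns
  -- add the length of the seplist to each exponent.
  ircont-weight : ∀ {is} → seplist S T ≡ is →
    (ircont S T 𝟙 , ircont S T 𝟚) ≡ (length is , length is) ∔ weight (word S T)
  ircont-weight refl = begin
    (inColumns 𝟙 ⟦ W ⟧ , inColumns 𝟚 ⟦ W ⟧)
      ≡⟨ cong (λ js → inColumns 𝟙 js , inColumns 𝟚 js) (⟦⟧≡columns W) ⟩
    (inColumns 𝟙 (columns 1 W) , inColumns 𝟚 (columns 1 W))
      ≡⟨ counts-from W 1 ℕ.≤-refl (ℕ.+-comm W 1) ⟩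
    (length (sepsFrom S T 1 W) , length (sepsFrom S T 1 W)) ∔ weight (word S T)
      ≡⟨ cong (λ is → (length is , length is) ∔ weight (word S T)) (sym (seplist≡ S T)) ⟩
    (length (seplist S T) , length (seplist S T)) ∔ weight (word S T) ∎
    where
    open ≡-Reasoning
    W = width S

module _ (S : SkewPartition) (connected : Connected S) (columns≢∅ : NoEmptyColumns S)
  (ν : Partition) (representable : Representable S ν) where
  open Geometry S
  open Counts ν representable

  Admits : Filling S → Set
  Admits T = IsRPP S T × seplist S T ≡ parts ν

  Admits? : Decidable Admits
  Admits? T = IsRPP? S T ×-dec List.≡-dec _≟_ (seplist S T) (parts ν)

  fillings-distinct : AllPairs (λ T T′ → ¬ T ≗ T′) (fillings S)
  fillings-distinct = AllPairs.map⁺ (AllPairs.map (λ i≢j e → i≢j (finToFun-injective e)) (Unique.allFin⁺ _))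

  words-distinct : Unique (map (word S) (RPP¹² S ν))
  words-distinct = AllPairs.map⁺ (AllPairs.map
    (λ ((rpp , e) , (rpp′ , e′) , T≢T′) w≡ → T≢T′ (word-injective S rpp rpp′ e e′ w≡))
    (AllPairs-All (All.all-filter Admits? (fillings S)) (AllPairs.filter⁺ Admits? fillings-distinct)))

  RPP⇒Admits : ∀ {T} → T ∈ˡ RPP¹² S ν → Admits T
  RPP⇒Admits = All.lookup (All.all-filter Admits? (fillings S))

  Admits⇒word : ∀ {T} → Admits T → word S T ∈ˡ words W 1 0 false
  Admits⇒word {T} (rpp , e) =
    words-complete (Forward.word-valid S connected columns≢∅ ν representable T rpp e)

  -- Neither list has repetitions, so equality of their sets of members suffices. One inclusion
  -- reads off the word of an rpp, the other builds a filling from a valid word.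
  RPP↭words : map (word S) (RPP¹² S ν) ↭ words W 1 0 false
  RPP↭words = ∼bag⇒↭ (unique∧set⇒bag words-distinct (words-unique W 1 0 false) (mk⇔ (to ∘ ∈-map⁻ (word S)) from))
    where
    to : ∀ {w} → (∃ λ T → T ∈ˡ RPP¹² S ν × w ≡ word S T) → w ∈ˡ words W 1 0 false
    to (T , T∈ , w≡) = subst (_∈ˡ words W 1 0 false) (sym w≡) (Admits⇒word (RPP⇒Admits T∈))
    from : ∀ {w} → w ∈ˡ words W 1 0 false → w ∈ˡ map (word S) (RPP¹² S ν)
    from {w} w∈ = subst (_∈ˡ map (word S) (RPP¹² S ν)) (proj₁ determined)
      (∈-map⁺ (word S) (∈-filter⁺ Admits? (∈-map⁺ finToFun (∈-allFin (funToFin (B.build w valid))))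
        (B.build-rpp w valid T T≗ , proj₂ determined)))
      where
      module B = Backward S columns≢∅ ν representable
      valid = words-sound W w∈
      T : Filling S
      T = finToFun (funToFin (B.build w valid))
      T≗ : ∀ c → T c ≡ B.build w valid c
      T≗ = Fin.finToFun-funToFin (B.build w valid)
      determined = B.build-determined w valid T T≗

corollary7p7 : (S : SkewPartition) → Connected S → NoEmptyColumns S →
    (ν : Partition) → Representable S ν →
    (D : IrreducibleDecomposition S ν) →
    ∑ (map (x^ircont S) (RPP¹² S ν))
    ≈ (x₁ ⊗ x₂) ^ (# ν) ⊗ ∏ (map P (IrreducibleDecomposition.degrees D))
corollary7p7 S connected columns≢∅ ν representable D =
  ≈-trans (∑-monomials (x^ircont S) irconts (λ T → x₁x₂-monomial (ircont S T 𝟙) (ircont S T 𝟚)) (RPP¹² S ν))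
  (≈-trans (⟪⟫-↭ irconts↭)
    λ p q → sym (≈-trans (⊗-cong ([x₁x₂]^-monomial (# ν)) (∏P-⟪⟫ degrees))
      (monomial-⊗-⟪⟫ (# ν , # ν) (∏P-exponents degrees)) p q))
  where
  open IrreducibleDecomposition D using (degrees)
  irconts : Filling S → Exponent
  irconts T = ircont S T 𝟙 , ircont S T 𝟚
  irconts↭ : map irconts (RPP¹² S ν) ↭ map ((# ν , # ν) ∔_) (∏P-exponents degrees)
  irconts↭ = ↭-trans
    (↭-reflexive (trans
      (List.map-cong-local (All.map (λ {T} (rpp , e) → ircont-weight S columns≢∅ T rpp e)
        (All.all-filter (Admits? S connected columns≢∅ ν representable) (fillings S))))
      (trans (List.map-∘ {g = (# ν , # ν) ∔_} {f = weight ∘ word S} (RPP¹² S ν))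
        (cong (map ((# ν , # ν) ∔_)) (List.map-∘ (RPP¹² S ν))))))
    (map⁺ ((# ν , # ν) ∔_)
      (↭-trans (map⁺ weight (RPP↭words S connected columns≢∅ ν representable))
        (weights-irreducible S ν representable D)))
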